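{- Let $G$ be a finite graph that contains no triangle ($K_3$) as an induced subgraph and contains no induced subgraph that is a subdivision of $K_4$. Then $\chi(G)\leq 4$.
   Context: A subdivision of a graph is obtained by replacing its edges by paths of arbitrary length (at least one), with pairwise internally disjoint paths. $\chi(G)$ denotes the chromatic number of $G$. -}

module Defs where

open import Data.Nat using (ℕ)
open import Data.Fin using (Fin; zero; suc)
open import Data.List using (List; _∷_; []; _++_; [_])
open import Data.List.Relation.Unary.Linked using (Linked)
open import Data.List.Relation.Unary.Unique.Propositional using (Unique)
open import Data.List.Membership.Propositional using (_∈_)
open import Data.Product using (Σ; ∃; ∃-syntax; _×_; _,_)
open import Data.Sum using (_⊎_)
open import Function.Definitions using (Injective)
open import Relation.Binary.PropositionalEquality using (_≡_; _≢_)
open import Relation.Nullary using (¬_; Dec)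

record Graph (n : ℕ) : Set₁ where
  field
    Adj    : Fin n → Fin n → Set
    adj?   : ∀ u v → Dec (Adj u v)
    sym    : ∀ {u v} → Adj u v → Adj v u
    irrefl : ∀ {u} → ¬ Adj u u
open Graph public

ProperColouring : ∀ {n} → Graph n → (k : ℕ) → (Fin n → Fin k) → Set
ProperColouring G k c = ∀ u v → Adj G u v → c u ≢ c v

ChromaticAtMost : ∀ {n} → Graph n → ℕ → Set
ChromaticAtMost {n} G k = Σ (Fin n → Fin k) (ProperColouring G k)

-- G contains a triangle (for three vertices, induced = subgraph).
HasTriangle : ∀ {n} → Graph n → Set
HasTriangle G = ∃[ u ] ∃[ v ] ∃[ w ] (Adj G u v × Adj G v w × Adj G u w)

-- The six edges of K4 on branch vertices Fin 4.
end₁ end₂ : Fin 6 → Fin 4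
end₁ zero = zero
end₁ (suc zero) = zero
end₁ (suc (suc zero)) = zero
end₁ (suc (suc (suc zero))) = suc zero
end₁ (suc (suc (suc (suc zero)))) = suc zero
end₁ (suc (suc (suc (suc (suc zero))))) = suc (suc zero)
end₂ zero = suc zero
end₂ (suc zero) = suc (suc zero)
end₂ (suc (suc zero)) = suc (suc (suc zero))
end₂ (suc (suc (suc zero))) = suc (suc zero)
end₂ (suc (suc (suc (suc zero)))) = suc (suc (suc zero))
end₂ (suc (suc (suc (suc (suc zero))))) = suc (suc (suc zero))

data Consecutive {A : Set} (u v : A) : List A → Set where
  here  : ∀ {l} → Consecutive u v (u ∷ v ∷ l)
  there : ∀ {x l} → Consecutive u v l → Consecutive u v (x ∷ l)

-- An induced subgraph of G which is a subdivision of K4: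
-- four distinct branch vertices b, and for each edge e = {end₁ e, end₂ e}
-- of K4 a path  b (end₁ e) ∷ inner e ++ [ b (end₂ e) ]  in G (inner e may be
-- empty), the paths being internally disjoint and avoiding other branch
-- vertices; inducedness: every edge of G between vertices of the union of
-- the paths joins two consecutive vertices of one of the paths.
record InducedK4Subdivision {n} (G : Graph n) : Set where
  field
    branch : Fin 4 → Fin n
    inner  : Fin 6 → List (Fin n)
  path : Fin 6 → List (Fin n)
  path e = branch (end₁ e) ∷ inner e ++ [ branch (end₂ e) ]
  InH : Fin n → Set
  InH v = (∃[ i ] v ≡ branch i) ⊎ (∃[ e ] v ∈ inner e)
  field
    branch-inj   : Injective _≡_ _≡_ branch
    path-linked  : ∀ e → Linked (Adj G) (path e)
    inner-unique : ∀ e → Unique (inner e)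
    inner-not-branch : ∀ e i → ¬ (branch i ∈ inner e)
    inner-disjoint   : ∀ e e' v → v ∈ inner e → v ∈ inner e' → e ≡ e'
    induced : ∀ u v → InH u → InH v → Adj G u v →
              ∃[ e ] (Consecutive u v (path e) ⊎ Consecutive v u (path e))

{-# OPTIONS --safe #-}
module Submission where

open import Defs
open import Data.Nat using (ℕ; zero; suc; _≤_; _<_; z≤n; s≤s; s≤s⁻¹)
import Data.Nat.Properties as ℕ
open import Data.Fin using (Fin; zero; suc; toℕ; fromℕ<; combine)
open import Data.Fin.Patterns using (0F; 1F; 2F; 3F; 4F; 5F)
import Data.Fin.Properties as Fin
open import Data.List using (List; []; _∷_; _++_; [_]; lookup; length)
open import Data.List.Properties using (++-assoc)
open import Data.List.Membership.Propositional using (_∈_; _∉_; lose)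
open import Data.List.Membership.Propositional.Properties using (∈-++⁻; ∈-++⁺ˡ; ∈-++⁺ʳ; ∈-lookup)
open import Data.List.Relation.Unary.All as All using ([]; _∷_)
open import Data.List.Relation.Unary.AllPairs using (AllPairs; []; _∷_)
open import Data.List.Relation.Unary.Any using (Any; here; there; any?)
open import Data.List.Relation.Unary.Linked using (Linked; []; [-]; _∷_)
open import Data.List.Relation.Unary.Unique.Propositional using (Unique)
open import Data.Product using (∃-syntax; _×_; _,_; proj₁; proj₂)
open import Data.Sum using (_⊎_; inj₁; inj₂; [_,_]′)
open import Data.Empty using (⊥; ⊥-elim)
open import Data.Unit using (⊤; tt)
open import Function using (_∘_; id)
open import Relation.Binary.PropositionalEquality using (_≡_; _≢_; refl; cong; subst; trans) renaming (sym to ≡-sym)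
open import Relation.Nullary using (¬_; Dec; yes; no; contradiction)
open import Relation.Nullary.Decidable using (_×-dec_; _⊎-dec_; ¬?)

-- Layer each component of G by the distance to a root and let N_i be the i-th layer. The point is
-- that no layer contains an induced cycle of length at least 5; since G has no triangle, every layer
-- is then bipartite, and two pairs of colours, used alternately on even and odd layers, suffice.
--
-- Every induced K4 subdivision below comes from one configuration (`fan`): an induced cycle O and a
-- connected set K off O such that exactly three vertices of O have neighbours in K, and each of the
-- three has exactly one; joining the three inside K by an induced subdivided claw gives the
-- subdivision.
--
-- Let O be an induced cycle of length at least 5 in a layer N_i, and let c, y, d be consecutive on O.
-- (1) If c and d have parents q ≁ d and r ≁ c in N_{i-1}, take a parent p of y and extend the three
-- paths y-c-q, y-p, y-d-r upwards layer by layer until they meet (`climb`): either a fan appears on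
-- the way, or they meet in a single vertex t and form an induced theta. Walking along O from c away
-- from y, the first vertex that sees p, r or d closes a fan with the theta.
-- (2) Hence c and d have a common parent; likewise y and the vertex e following d on O have one.
-- The path c-y-d-e, these two parents and a path joining them through layers nearer to the root contain a fan.

-- Lists: last entries and first occurrences.

data Last {A : Set} : List A → A → Set where
  last  : ∀ {x} → Last [ x ] x
  there : ∀ {x xs y} → Last xs y → Last (x ∷ xs) y

last-snoc : ∀ {A : Set} (xs : List A) {x} → Last (xs ++ [ x ]) x
last-snoc []       = last
last-snoc (_ ∷ xs) = there (last-snoc xs)

∃-last : ∀ {A : Set} (x : A) xs → ∃[ z ] Last (x ∷ xs) z
∃-last x []       = x , last
∃-last x (y ∷ xs) with z , p ← ∃-last y xs = z , there p

last-∈ : ∀ {A : Set} {xs : List A} {x} → Last xs x → x ∈ xs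
last-∈ last      = here refl
last-∈ (there p) = there (last-∈ p)

last⇒snoc : ∀ {A : Set} {xs : List A} {x} → Last xs x → ∃[ ys ] xs ≡ ys ++ [ x ]
last⇒snoc last = [] , refl
last⇒snoc (there p) with ys , refl ← last⇒snoc p = _ ∷ ys , refl

last-tail : ∀ {A : Set} {x y : A} {xs} → x ≢ y → Last (x ∷ xs) y → Last xs y
last-tail x≢y last      = contradiction refl x≢y
last-tail x≢y (there p) = p

∈-snoc⁻ : ∀ {A : Set} (xs : List A) {x v} → v ∈ xs ++ [ x ] → v ∈ xs ⊎ v ≡ x
∈-snoc⁻ xs m with ∈-++⁻ xs m
... | inj₁ v∈        = inj₁ v∈
... | inj₂ (here eq) = inj₂ eq

∈-snoc : ∀ {A : Set} (xs : List A) {x} → x ∈ xs ++ [ x ]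
∈-snoc xs = ∈-++⁺ʳ xs (here refl)

first-such : ∀ {A : Set} {P : A → Set} → (∀ x → Dec (P x)) → ∀ {xs} → Any P xs →
             ∃[ ys ] ∃[ x ] ∃[ zs ] xs ≡ ys ++ x ∷ zs × P x × (∀ {v} → v ∈ ys → ¬ P v)
first-such P? {x ∷ xs} m with P? x
... | yes p = [] , x , xs , refl , p , λ ()
first-such P? (here p)  | no ¬p = contradiction p ¬p
first-such P? {x ∷ xs} (there m) | no ¬p with ys , y , zs , refl , q , none ← first-such P? m =
  x ∷ ys , y , zs , refl , q , λ { (here refl) → ¬p ; (there v∈) → none v∈ }

-- Induced paths, and walks shortened to them.

module InducedPaths {n : ℕ} (G : Graph n) where

  V : Set
  V = Fin n

  infix 4 _~_ _#_ _#*_ _⟂_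

  _~_ : V → V → Set
  _~_ = Adj G

  -- Distinctness is part of the relation, so that `⟂` between two lists says at once that they are
  -- disjoint and that no edge joins them.
  _#_ : V → V → Set
  u # v = u ≢ v × ¬ (u ~ v)

  #-sym : ∀ {u v} → u # v → v # u
  #-sym (u≢v , u≁v) = (λ eq → u≢v (≡-sym eq)) , (λ e → u≁v (sym G e))

  ~⇒≢ : ∀ {u v} → u ~ v → u ≢ v
  ~⇒≢ e refl = irrefl G e

  _#*_ : V → List V → Set
  x #* ys = ∀ {v} → v ∈ ys → x # v

  _⟂_ : List V → List V → Set
  xs ⟂ ys = ∀ {u v} → u ∈ xs → v ∈ ys → u # v

  ⟂-sym : ∀ {xs ys} → xs ⟂ ys → ys ⟂ xs
  ⟂-sym f u∈ v∈ = #-sym (f v∈ u∈)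

  #*-++ : ∀ {x} ys {zs} → x #* ys → x #* zs → x #* (ys ++ zs)
  #*-++ ys f g m = [ f , g ]′ (∈-++⁻ ys m)

  #*-∷ : ∀ {x y zs} → x # y → x #* zs → x #* (y ∷ zs)
  #*-∷ f g (here refl) = f
  #*-∷ f g (there m)   = g m

  -- Induced paths. The clause `x #* l` skips only the successor of `x`, which differs from `x` by
  -- irreflexivity, so freedom from repetition is built in.
  data Ind : List V → Set where
    []   : Ind []
    [-]  : ∀ {x} → Ind [ x ]
    cons : ∀ {x y l} → x ~ y → x #* l → Ind (y ∷ l) → Ind (x ∷ y ∷ l)

  edge : ∀ {x y} → x ~ y → Ind (x ∷ y ∷ [])
  edge e = cons e (λ ()) [-]

  ind-tail : ∀ {x l} → Ind (x ∷ l) → Ind l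
  ind-tail [-]          = []
  ind-tail (cons _ _ i) = i

  ind-split : ∀ xs {x ys} → Ind (xs ++ x ∷ ys) → Ind (xs ++ [ x ]) × Ind (x ∷ ys) × xs ⟂ ys
  ind-split [] i = [-] , i , (λ ())
  ind-split (a ∷ []) (cons e f i) = edge e , i , λ { (here refl) → f }
  ind-split (a ∷ b ∷ xs) (cons e f i) with i₁ , i₂ , g ← ind-split (b ∷ xs) i =
    cons e (#*-++ xs (f ∘ ∈-++⁺ˡ) (λ { (here refl) → f (∈-++⁺ʳ xs (here refl)) })) i₁ , i₂ ,
    λ { (here refl) v∈ → f (∈-++⁺ʳ xs (there v∈)) ; (there u∈) v∈ → g u∈ v∈ }

  ind-join : ∀ xs {x ys} → Ind (xs ++ [ x ]) → Ind (x ∷ ys) → xs ⟂ ys → Ind (xs ++ x ∷ ys)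
  ind-join [] _ i _ = i
  ind-join (a ∷ []) (cons e _ _) i g = cons e (g (here refl)) i
  ind-join (a ∷ b ∷ xs) {x} (cons e f i₁) i₂ g =
    cons e (#*-++ xs (f ∘ ∈-++⁺ˡ) (#*-∷ (f (∈-snoc xs)) (g (here refl))))
      (ind-join (b ∷ xs) i₁ i₂ (g ∘ there))

  ind-snoc : ∀ {xs z w} → Ind xs → Last xs z → z ~ w → (∀ {v} → v ∈ xs → v ≢ z → v # w) → Ind (xs ++ [ w ])
  ind-snoc i last e f = edge e
  ind-snoc [-] (there ())
  ind-snoc {x ∷ y ∷ l} {z} (cons e f i) (there p) zw g =
    cons e (#*-++ l f (λ { (here refl) → g (here refl) x≢z })) (ind-snoc i p zw (g ∘ there))
    where
    x≢z : x ≢ z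
    x≢z refl with last-∈ p
    ... | here refl = irrefl G e
    ... | there m   = proj₁ (f m) refl

  ind-∉ : ∀ {x l} → Ind (x ∷ l) → x ∉ l
  ind-∉ (cons e f i) (here refl) = irrefl G e
  ind-∉ (cons e f i) (there m)   = proj₁ (f m) refl

  ind-inner : ∀ xs {x} → Ind (xs ++ [ x ]) → Ind xs × x ∉ xs
  ind-inner [] i = [] , λ ()
  ind-inner (y ∷ []) (cons e f i) = [-] , λ { (here refl) → irrefl G e }
  ind-inner (y ∷ z ∷ xs) (cons e f i) with j , x∉ ← ind-inner (z ∷ xs) i =
    cons e (f ∘ ∈-++⁺ˡ) j , λ { (here refl) → proj₁ (f (∈-snoc xs)) refl ; (there m) → x∉ m }

  ind-unique : ∀ {xs} → Ind xs → Unique xs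
  ind-unique [] = []
  ind-unique {x ∷ l} i = All.tabulate (λ m → λ { refl → ind-∉ i m }) ∷ ind-unique (ind-tail i)

  ind-linked : ∀ {xs} → Ind xs → Linked _~_ xs
  ind-linked [] = []
  ind-linked [-] = [-]
  ind-linked (cons e _ i) = e ∷ ind-linked i

  ind-consecutive : ∀ {xs u v} → Ind xs → u ∈ xs → v ∈ xs → u ~ v →
                    Consecutive u v xs ⊎ Consecutive v u xs
  ind-consecutive i (here refl) (here refl) e = contradiction e (irrefl G)
  ind-consecutive i (here refl) (there (here refl)) e = inj₁ here
  ind-consecutive (cons _ f _) (here refl) (there (there m)) e = contradiction e (proj₂ (f m))
  ind-consecutive i (there (here refl)) (here refl) e = inj₂ here
  ind-consecutive (cons _ f _) (there (there m)) (here refl) e = contradiction (sym G e) (proj₂ (f m))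
  ind-consecutive i (there u∈) (there v∈) e with ind-consecutive (ind-tail i) u∈ v∈ e
  ... | inj₁ c = inj₁ (there c)
  ... | inj₂ c = inj₂ (there c)

  ind-head-≢ : ∀ {x y} l → Ind (x ∷ l ++ [ y ]) → x ≢ y
  ind-head-≢ l i refl = ind-∉ i (∈-snoc l)

  ind-second : ∀ {x y l v} → Ind (x ∷ y ∷ l) → v ∈ y ∷ l → x ~ v → v ≡ y
  ind-second i (here eq) e = eq
  ind-second (cons _ f _) (there m) e = contradiction e (proj₂ (f m))

  ind-last : ∀ {l z w v} → Ind (l ++ [ w ]) → Last l z → v ∈ l → w ~ v → v ≡ z
  ind-last i last (here eq) e = eq
  ind-last {x ∷ y ∷ l} (cons _ f _) (there p) (here refl) e =
    contradiction (sym G e) (proj₂ (f (∈-snoc l)))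
  ind-last {x ∷ y ∷ l} i (there p) (there m) e = ind-last (ind-tail i) p m e

  ind-last-~ : ∀ {l z w} → Ind (l ++ [ w ]) → Last l z → w ~ z
  ind-last-~ (cons e _ _) last = sym G e
  ind-last-~ i (there {xs = _ ∷ _} p) = ind-last-~ (ind-tail i) p

  data Walk (K : V → Set) : V → V → Set where
    nil  : ∀ {a} → K a → Walk K a a
    step : ∀ {a b c} → K a → a ~ b → Walk K b c → Walk K a c

  module _ {K : V → Set} where

    infixr 5 _++ʷ_

    _++ʷ_ : ∀ {a b c} → Walk K a b → Walk K b c → Walk K a c
    nil _ ++ʷ w      = w
    step k e v ++ʷ w = step k e (v ++ʷ w)

    walk-sym : ∀ {a b} → Walk K a b → Walk K b a
    walk-sym (nil k) = nil k
    walk-sym (step k e w) = walk-sym w ++ʷ step (walk-start w) (sym G e) (nil k)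
      where
      walk-start : ∀ {a b} → Walk K a b → K a
      walk-start (nil k)      = k
      walk-start (step k _ _) = k

    path-walk : ∀ {x l v} → Ind (x ∷ l) → (∀ {u} → u ∈ x ∷ l → K u) → v ∈ x ∷ l → Walk K x v
    path-walk i f (here refl) = nil (f (here refl))
    path-walk (cons e _ i) f (there m) = step (f (here refl)) e (path-walk i (f ∘ there) m)

  walk-map : ∀ {K L : V → Set} {a b} → (∀ {v} → K v → L v) → Walk K a b → Walk L a b
  walk-map f (nil k)      = nil (f k)
  walk-map f (step k e w) = step (f k) e (walk-map f w)

  _~?_ : ∀ u v → Dec (u ~ v)
  _~?_ = adj? G

  no-neighbour : ∀ {z xs} → z ∉ xs → ¬ Any (z ~_) xs → z #* xs
  no-neighbour z∉ ¬m v∈ = (λ { refl → z∉ v∈ }) , λ e → ¬m (lose v∈ e)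

  suffix : ∀ {a b xs} → Ind xs → Last xs b → a ∈ xs →
           ∃[ l ] Ind (a ∷ l) × Last (a ∷ l) b × (∀ {v} → v ∈ a ∷ l → v ∈ xs)
  suffix i p (here refl) = _ , i , p , id
  suffix i (there p) (there m) with l , j , q , s ← suffix (ind-tail i) p m = l , j , q , there ∘ s

  -- The new edge goes to the last neighbour of `a` on the path. No later vertex is adjacent to `a`,
  -- so `a` followed by the suffix from there is induced.
  shortcut : ∀ {a b xs} → Ind xs → Last xs b → a ∉ xs → Any (a ~_) xs →
             ∃[ l ] Ind (a ∷ l) × Last l b × (∀ {v} → v ∈ l → v ∈ xs)
  shortcut {a} {xs = x ∷ xs} i p a∉ m with any? (a ~?_) xs
  shortcut i (there p) a∉ _ | yes m with l , j , q , s ← shortcut (ind-tail i) p (a∉ ∘ there) m =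
    l , j , q , there ∘ s
  shortcut i last a∉ _ | yes ()
  shortcut {a} {xs = x ∷ xs} i p a∉ (there m) | no ¬m = contradiction m ¬m
  shortcut {a} {xs = x ∷ xs} i p a∉ (here e)  | no ¬m = x ∷ xs , cons e (no-neighbour (a∉ ∘ there) ¬m) i , p , id

  _∈?_ : ∀ (a : V) xs → Dec (a ∈ xs)
  a ∈? xs = any? (a Fin.≟_) xs

  -- Induction along the walk: a new first vertex either lies on the induced path already, which is
  -- then cut at it, or is joined to it by `shortcut`.
  walk⇒path : ∀ {K a b} → Walk K a b →
              ∃[ l ] Ind (a ∷ l) × Last (a ∷ l) b × (∀ {v} → v ∈ a ∷ l → K v)
  walk⇒path (nil k) = [] , [-] , last , λ { (here refl) → k }
  walk⇒path {a = a} (step k e w) with walk⇒path w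
  ... | l , i , p , s with a ∈? (_ ∷ l)
  ...   | yes m with l' , j , q , t ← suffix i p m = l' , j , q , s ∘ t
  ...   | no a∉ with l' , j , q , t ← shortcut i p a∉ (here e) =
    l' , j , there q , λ { (here refl) → k ; (there m) → s (t m) }

  walk⇒path′ : ∀ {K a b} → a ≢ b → Walk K a b → ∃[ l ] Ind (a ∷ l ++ [ b ]) × (∀ {v} → v ∈ l → K v)
  walk⇒path′ a≢b w with l , i , p , s ← walk⇒path w with last⇒snoc (last-tail a≢b p)
  ... | l' , refl = l' , i , s ∘ there ∘ ∈-++⁺ˡ

  first-neighbour : ∀ {z xs} → z ∉ xs → Any (z ~_) xs →
                    ∃[ ys ] ∃[ x ] ∃[ zs ] xs ≡ ys ++ x ∷ zs × z ~ x × z #* ys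
  first-neighbour {z} z∉ m with ys , x , zs , refl , e , none ← first-such (z ~?_) m =
    ys , x , zs , refl , e , λ v∈ → (λ { refl → z∉ (∈-++⁺ˡ v∈) }) , none v∈

  last-neighbour : ∀ {z xs} → z ∉ xs → Any (z ~_) xs →
                   ∃[ ys ] ∃[ x ] ∃[ zs ] xs ≡ ys ++ x ∷ zs × z ~ x × z #* zs
  last-neighbour {z} {x ∷ xs} z∉ m with any? (z ~?_) xs
  ... | yes m' with ys , y , zs , refl , e , f ← last-neighbour (z∉ ∘ there) m' =
    x ∷ ys , y , zs , refl , e , f
  last-neighbour z∉ (there m) | no ¬m = contradiction m ¬m
  last-neighbour {z} {x ∷ xs} z∉ (here e) | no ¬m =
    [] , x , xs , refl , e , no-neighbour (z∉ ∘ there) ¬m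

  -- The walk is stopped at its first vertex `z` with a neighbour in `R`. A vertex without
  -- neighbours in `R` is followed by a vertex off `R`, so `R` is never entered; shortening to an
  -- induced path keeps the end `z`.
  attach : ∀ {K a b R} → Walk K a b → b ∈ R → a ∉ R →
           ∃[ l ] ∃[ z ] Ind (a ∷ l) × Last (a ∷ l) z × (∀ {v} → v ∈ a ∷ l → K v) ×
             Any (z ~_) R × (∀ {v} → v ∈ a ∷ l → v ∉ R) × (∀ {v} → v ∈ a ∷ l → v ≢ z → v #* R)
  attach (nil k) b∈ a∉ = contradiction b∈ a∉
  attach {a = a} {R = R} (step {b = a'} k e w) b∈ a∉ with any? (a ~?_) R
  ... | yes m = [] , a , [-] , last , (λ { (here refl) → k }) , m , (λ { (here refl) → a∉ }) ,
                λ { (here refl) a≢a → contradiction refl a≢a }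
  ... | no ¬m with attach w b∈ (λ a'∈ → ¬m (lose a'∈ e))
  ...   | l , z , i , p , s , m , out , far with a ∈? (a' ∷ l)
  ...     | yes a∈ with l' , j , q , t ← suffix i p a∈ =
    l' , z , j , q , s ∘ t , m , out ∘ t , far ∘ t
  ...     | no a∉l with l' , j , q , t ← shortcut i p a∉l (here e) =
    l' , z , j , there q , (λ { (here refl) → k ; (there v∈) → s (t v∈) }) , m ,
    (λ { (here refl) → a∉ ; (there v∈) → out (t v∈) }) ,
    λ { (here refl) _ → no-neighbour a∉ ¬m ; (there v∈) → far (t v∈) }

-- Induced subdivisions of K4 from a hole and a connected set.

edge-between : ∀ i j → i ≢ j → ∃[ e ] ((end₁ e ≡ i × end₂ e ≡ j) ⊎ (end₁ e ≡ j × end₂ e ≡ i))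
edge-between 0F 0F ne = contradiction refl ne
edge-between 0F 1F ne = 0F , inj₁ (refl , refl)
edge-between 0F 2F ne = 1F , inj₁ (refl , refl)
edge-between 0F 3F ne = 2F , inj₁ (refl , refl)
edge-between 1F 0F ne = 0F , inj₂ (refl , refl)
edge-between 1F 1F ne = contradiction refl ne
edge-between 1F 2F ne = 3F , inj₁ (refl , refl)
edge-between 1F 3F ne = 4F , inj₁ (refl , refl)
edge-between 2F 0F ne = 1F , inj₂ (refl , refl)
edge-between 2F 1F ne = 3F , inj₂ (refl , refl)
edge-between 2F 2F ne = contradiction refl ne
edge-between 2F 3F ne = 5F , inj₁ (refl , refl)
edge-between 3F 0F ne = 2F , inj₂ (refl , refl)
edge-between 3F 1F ne = 4F , inj₂ (refl , refl)
edge-between 3F 2F ne = 5F , inj₂ (refl , refl)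
edge-between 3F 3F ne = contradiction refl ne

module K4 {n : ℕ} (G : Graph n) where

  open InducedPaths G

  pairwise : ∀ {xss} → AllPairs _⟂_ xss → ∀ i j → i ≢ j → lookup xss i ⟂ lookup xss j
  pairwise (fs ∷ ps) zero    zero    ne = contradiction refl ne
  pairwise (fs ∷ ps) zero    (suc j) ne = All.lookup fs (∈-lookup j)
  pairwise (fs ∷ ps) (suc i) zero    ne = ⟂-sym (All.lookup fs (∈-lookup i))
  pairwise (fs ∷ ps) (suc i) (suc j) ne = pairwise ps i j (ne ∘ cong suc)

  module _ (b : Fin 4 → V) (inner : Fin 6 → List V)
           (paths : ∀ e → Ind (b (end₁ e) ∷ inner e ++ [ b (end₂ e) ]))
           (apart : ∀ e e' → e ≢ e' → inner e ⟂ inner e')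
           (off : ∀ e i → i ≢ end₁ e → i ≢ end₂ e → b i #* inner e) where

    private
      path : Fin 6 → List V
      path e = b (end₁ e) ∷ inner e ++ [ b (end₂ e) ]

      b-≢ : ∀ {i j} → i ≢ j → b i ≢ b j
      b-≢ {i} {j} ne with edge-between i j ne
      ... | e , inj₁ (refl , refl) = ind-head-≢ (inner e) (paths e)
      ... | e , inj₂ (refl , refl) = ind-head-≢ (inner e) (paths e) ∘ ≡-sym

      end₁∈ : ∀ e → b (end₁ e) ∈ path e
      end₁∈ e = here refl

      end₂∈ : ∀ e → b (end₂ e) ∈ path e
      end₂∈ e = there (∈-snoc (inner e))

      inner∈ : ∀ e {v} → v ∈ inner e → v ∈ path e
      inner∈ e = there ∘ ∈-++⁺ˡ

      Vertex : V → Set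
      Vertex v = (∃[ i ] v ≡ b i) ⊎ (∃[ e ] v ∈ inner e)

      -- Any two branch vertices are the ends of one of the paths, and `off` and `apart` exclude
      -- every edge between different paths; this reduces inducedness of the union to that of each
      -- path.
      same-path : ∀ {u v} → Vertex u → Vertex v → u ~ v → ∃[ e ] (u ∈ path e × v ∈ path e)
      same-path (inj₁ (i , refl)) (inj₁ (j , refl)) a with i Fin.≟ j
      ... | yes refl = contradiction a (irrefl G)
      ... | no ne with edge-between i j ne
      ...   | e , inj₁ (refl , refl) = e , end₁∈ e , end₂∈ e
      ...   | e , inj₂ (refl , refl) = e , end₂∈ e , end₁∈ e
      same-path (inj₁ (i , refl)) (inj₂ (e , v∈)) a with i Fin.≟ end₁ e | i Fin.≟ end₂ e
      ... | yes refl | _        = e , end₁∈ e , inner∈ e v∈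
      ... | no _     | yes refl = e , end₂∈ e , inner∈ e v∈
      ... | no ne₁   | no ne₂   = contradiction a (proj₂ (off e i ne₁ ne₂ v∈))
      same-path (inj₂ (e , u∈)) (inj₁ (i , refl)) a with i Fin.≟ end₁ e | i Fin.≟ end₂ e
      ... | yes refl | _        = e , inner∈ e u∈ , end₁∈ e
      ... | no _     | yes refl = e , inner∈ e u∈ , end₂∈ e
      ... | no ne₁   | no ne₂   = contradiction (sym G a) (proj₂ (off e i ne₁ ne₂ u∈))
      same-path (inj₂ (e , u∈)) (inj₂ (e' , v∈)) a with e Fin.≟ e'
      ... | yes refl = e , inner∈ e u∈ , inner∈ e v∈
      ... | no ne    = contradiction a (proj₂ (apart e e' ne u∈ v∈))

    mkK4 : InducedK4Subdivision G
    mkK4 = record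
      { branch = b
      ; inner = inner
      ; branch-inj = λ {i} {j} eq → branch-inj i j eq
      ; path-linked = λ e → ind-linked (paths e)
      ; inner-unique = λ e → ind-unique (proj₁ (ind-inner (inner e) (ind-tail (paths e))))
      ; inner-not-branch = not-branch
      ; inner-disjoint = disjoint
      ; induced = λ u v u∈ v∈ a → let e , p , q = same-path u∈ v∈ a in e , ind-consecutive (paths e) p q a
      }
      where
      branch-inj : ∀ i j → b i ≡ b j → i ≡ j
      branch-inj i j eq with i Fin.≟ j
      ... | yes i≡j = i≡j
      ... | no ne   = contradiction eq (b-≢ ne)
      not-branch : ∀ e i → ¬ (b i ∈ inner e)
      not-branch e i m with i Fin.≟ end₁ e | i Fin.≟ end₂ e
      ... | yes refl | _        = ind-∉ (paths e) (∈-++⁺ˡ m)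
      ... | no _     | yes refl = proj₂ (ind-inner (inner e) (ind-tail (paths e))) m
      ... | no ne₁   | no ne₂   = proj₁ (off e i ne₁ ne₂ m) refl
      disjoint : ∀ e e' v → v ∈ inner e → v ∈ inner e' → e ≡ e'
      disjoint e e' v m m' with e Fin.≟ e'
      ... | yes eq = eq
      ... | no ne  = contradiction refl (proj₁ (apart e e' ne m m'))

  -- An induced cycle through o₁, o₂, o₃, cut into arcs with interiors A (o₁ to o₂), B (o₁ to o₃), D (o₂ to o₃).
  record Hole (o₁ o₂ o₃ : V) (A B D : List V) : Set where
    field
      ind₁₂ : Ind (o₁ ∷ A ++ [ o₂ ])
      ind₁₃ : Ind (o₁ ∷ B ++ [ o₃ ])
      ind₂₃ : Ind (o₂ ∷ D ++ [ o₃ ])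
      A⟂B : A ⟂ B
      A⟂D : A ⟂ D
      B⟂D : B ⟂ D
      off₁ : o₁ #* D
      off₂ : o₂ #* B
      off₃ : o₃ #* A

  record Attached (o : V) (K : V → Set) (k : V) : Set where
    constructor attached
    field
      member : K k
      touch  : o ~ k
      out    : ∀ {v} → K v → o ≢ v
      only   : ∀ {v} → K v → o ~ v → v ≡ k

  module _ {o₁ o₂ o₃ A B D} (H : Hole o₁ o₂ o₃ A B D) {K : V → Set}
           (K⟂A : ∀ {v} → K v → v #* A) (K⟂B : ∀ {v} → K v → v #* B) (K⟂D : ∀ {v} → K v → v #* D) where

    open Hole H

    -- The six paths are the three arcs of the hole and the three legs of a claw with centre `t`.
    -- The branch vertices are ordered `o₁`, `o₂`, `t`, `o₃`, which is why the third leg runs from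
    -- `t` to `o₃`.
    spider⇒K4 : ∀ {t L₁ L₂ L₃} → K t →
      (∀ {v} → v ∈ L₁ → K v) → (∀ {v} → v ∈ L₂ → K v) → (∀ {v} → v ∈ L₃ → K v) →
      Ind (o₁ ∷ L₁ ++ [ t ]) → Ind (o₂ ∷ L₂ ++ [ t ]) → Ind (t ∷ L₃ ++ [ o₃ ]) →
      L₁ ⟂ L₂ → L₁ ⟂ L₃ → L₂ ⟂ L₃ →
      o₁ #* L₂ → o₁ #* L₃ → o₂ #* L₁ → o₂ #* L₃ → o₃ #* L₁ → o₃ #* L₂ →
      InducedK4Subdivision G
    spider⇒K4 {t} {L₁} {L₂} {L₃} kt k₁ k₂ k₃ i₁ i₂ i₃ l₁₂ l₁₃ l₂₃ o₁₂ o₁₃ o₂₁ o₂₃ o₃₁ o₃₂ =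
      mkK4 (lookup (o₁ ∷ o₂ ∷ t ∷ o₃ ∷ [])) (lookup (A ∷ L₁ ∷ B ∷ L₂ ∷ D ∷ L₃ ∷ [])) paths
        (pairwise
          ( (A⟂ k₁ ∷ A⟂B ∷ A⟂ k₂ ∷ A⟂D ∷ A⟂ k₃ ∷ [])
          ∷ ((λ u∈ v∈ → K⟂B (k₁ u∈) v∈) ∷ l₁₂ ∷ (λ u∈ v∈ → K⟂D (k₁ u∈) v∈) ∷ l₁₃ ∷ [])
          ∷ ((λ u∈ v∈ → #-sym (K⟂B (k₂ v∈) u∈)) ∷ B⟂D ∷ (λ u∈ v∈ → #-sym (K⟂B (k₃ v∈) u∈)) ∷ [])
          ∷ ((λ u∈ v∈ → K⟂D (k₂ u∈) v∈) ∷ l₂₃ ∷ [])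
          ∷ ((λ u∈ v∈ → #-sym (K⟂D (k₃ v∈) u∈)) ∷ [])
          ∷ []
          ∷ [] ))
        off
      where
      A⟂ : ∀ {L} → (∀ {v} → v ∈ L → K v) → A ⟂ L
      A⟂ k u∈ v∈ = #-sym (K⟂A (k v∈) u∈)
      paths : ∀ e → Ind (lookup (o₁ ∷ o₂ ∷ t ∷ o₃ ∷ []) (end₁ e) ∷ lookup (A ∷ L₁ ∷ B ∷ L₂ ∷ D ∷ L₃ ∷ []) e
                          ++ [ lookup (o₁ ∷ o₂ ∷ t ∷ o₃ ∷ []) (end₂ e) ])
      paths 0F = ind₁₂
      paths 1F = i₁
      paths 2F = ind₁₃
      paths 3F = i₂
      paths 4F = ind₂₃
      paths 5F = i₃
      off : ∀ e i → i ≢ end₁ e → i ≢ end₂ e →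
            lookup (o₁ ∷ o₂ ∷ t ∷ o₃ ∷ []) i #* lookup (A ∷ L₁ ∷ B ∷ L₂ ∷ D ∷ L₃ ∷ []) e
      off 0F 2F _ _ = K⟂A kt
      off 0F 3F _ _ = off₃
      off 1F 1F _ _ = o₂₁
      off 1F 3F _ _ = o₃₁
      off 2F 1F _ _ = off₂
      off 2F 2F _ _ = K⟂B kt
      off 3F 0F _ _ = o₁₂
      off 3F 3F _ _ = o₃₂
      off 4F 0F _ _ = off₁
      off 4F 2F _ _ = K⟂D kt
      off 5F 0F _ _ = o₁₃
      off 5F 1F _ _ = o₂₃
      off 0F 0F ne _ = contradiction refl ne
      off 0F 1F _ ne = contradiction refl ne
      off 1F 0F ne _ = contradiction refl ne
      off 1F 2F _ ne = contradiction refl ne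
      off 2F 0F ne _ = contradiction refl ne
      off 2F 3F _ ne = contradiction refl ne
      off 3F 1F ne _ = contradiction refl ne
      off 3F 2F _ ne = contradiction refl ne
      off 4F 1F ne _ = contradiction refl ne
      off 4F 3F _ ne = contradiction refl ne
      off 5F 2F ne _ = contradiction refl ne
      off 5F 3F _ ne = contradiction refl ne

    module _ (no-triangle : ¬ HasTriangle G) where

      -- The claw needed by `spider⇒K4` is found in `K`: an induced path `R` joins `k₁` to `k₃`, and
      -- an induced path from `o₂` runs until its end `z` sees `R`. The neighbours of `z` on `R`
      -- decide where the centre is.
      fan : ∀ {k₁ k₂ k₃} → Attached o₁ K k₁ → Attached o₂ K k₂ → Attached o₃ K k₃ →
            Walk K k₁ k₃ → Walk K k₂ k₃ → InducedK4Subdivision G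
      fan {k₁} {k₂} {k₃} a₁ a₂ a₃ w₁ w₂
        with R' , iR' , pR , sR ← walk⇒path w₁
        -- The set is enlarged by `o₂`, where this path starts; `z` is `o₂` itself when `k₂` already
        -- lies on `R`.
        with l , z , iZ , pZ , sZ , mZ , outZ , farZ ←
          attach {K = λ v → K v ⊎ v ≡ o₂}
            (step (inj₂ refl) (Attached.touch a₂) (walk-map inj₁ w₂)) (last-∈ pR)
            (λ m → Attached.out a₂ (sR m) refl)
        with R₁ , r , R₂ , eq , z~r , z#R₁ ← first-neighbour (outZ (last-∈ pZ)) mZ = result
        where
        R = k₁ ∷ R'

        sl : ∀ {v} → v ∈ l → K v
        sl m with sZ (there m)
        ... | inj₁ k    = k
        ... | inj₂ refl = contradiction m (ind-∉ iZ)

        k₁∈R : k₁ ∈ R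
        k₁∈R = here refl

        k₃∈R : k₃ ∈ R
        k₃∈R = last-∈ pR

        io₁R : Ind (o₁ ∷ R)
        io₁R = cons (Attached.touch a₁) (λ m → Attached.out a₁ (sR (there m)) ,
                 λ e → ind-∉ iR' (subst (_∈ R') (Attached.only a₁ (sR (there m)) e) m)) iR'

        iRo₃ : Ind (R ++ [ o₃ ])
        iRo₃ = ind-snoc iR' pR (sym G (Attached.touch a₃))
                 λ m ne → #-sym (Attached.out a₃ (sR m) , λ e → ne (Attached.only a₃ (sR m) e))

        io₁R′ : Ind ((o₁ ∷ R₁) ++ r ∷ R₂)
        io₁R′ = subst (λ L → Ind (o₁ ∷ L)) eq io₁R

        iRo₃′ : Ind (R₁ ++ r ∷ (R₂ ++ [ o₃ ]))
        iRo₃′ = subst Ind (trans (cong (_++ [ o₃ ]) eq) (++-assoc R₁ (r ∷ R₂) [ o₃ ])) iRo₃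

        inR : ∀ {v} → v ∈ R₁ ++ r ∷ R₂ → v ∈ R
        inR {v} = subst (v ∈_) (≡-sym eq)

        inK : ∀ {v} → v ∈ R₁ ++ r ∷ R₂ → K v
        inK = sR ∘ inR

        -- The path l meets neither k₁ nor k₃, the only possible neighbours of o₁ and o₃ in K.
        not-on-R : ∀ {o k} → Attached o K k → k ∈ R → o #* l
        not-on-R a k∈ m = Attached.out a (sl m) ,
          λ e → outZ (there m) (subst (_∈ R) (≡-sym (Attached.only a (sl m) e)) k∈)

        result : InducedK4Subdivision G
        result with any? (z ~?_) R₂
        -- A single neighbour r of z on R: the centre is r.
        ... | no ¬m = spider⇒K4 (inK (∈-++⁺ʳ R₁ (here refl))) (inK ∘ ∈-++⁺ˡ) sl (inK ∘ ∈-++⁺ʳ R₁ ∘ there)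
            (proj₁ split₁) (ind-snoc iZ pZ z~r λ m ne → farZ m ne (inR (∈-++⁺ʳ R₁ (here refl))))
            (proj₁ (proj₂ split₃))
            (λ u∈ v∈ → #-sym (l#R₁ (there v∈) u∈)) (λ u∈ → proj₂ (proj₂ split₁) (there u∈)) (λ u∈ → l#R₂ (there u∈))
            (not-on-R a₁ k₁∈R) (proj₂ (proj₂ split₁) (here refl)) (l#R₁ (here refl)) (l#R₂ (here refl))
            (λ v∈ → #-sym (proj₂ (proj₂ split₃) v∈ (∈-snoc R₂))) (not-on-R a₃ k₃∈R)
          where
          split₁ = ind-split (o₁ ∷ R₁) io₁R′
          split₃ = ind-split R₁ iRo₃′
          z#R₂ : z #* R₂
          z#R₂ = no-neighbour (λ m → outZ (last-∈ pZ) (inR (∈-++⁺ʳ R₁ (there m)))) ¬m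
          l#R₁ : (o₂ ∷ l) ⟂ R₁
          l#R₁ {u} u∈ v∈ with u Fin.≟ z
          ... | yes refl = z#R₁ v∈
          ... | no ne    = farZ u∈ ne (inR (∈-++⁺ˡ v∈))
          l#R₂ : (o₂ ∷ l) ⟂ R₂
          l#R₂ {u} u∈ v∈ with u Fin.≟ z
          ... | yes refl = z#R₂ v∈
          ... | no ne    = farZ u∈ ne (inR (∈-++⁺ʳ R₁ (there v∈)))
        -- Several neighbours: the centre is z, and R is cut between the first and the last of them.
        ... | yes m with R₃ , r' , R₄ , refl , z~r' , z#R₄ ←
                   last-neighbour (λ m → outZ (last-∈ pZ) (inR (∈-++⁺ʳ R₁ (there m)))) m = result′
          where
          r∈ : r ∈ R₁ ++ r ∷ (R₃ ++ r' ∷ R₄)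
          r∈ = ∈-++⁺ʳ R₁ (here refl)
          r'∈ : r' ∈ R₁ ++ r ∷ (R₃ ++ r' ∷ R₄)
          r'∈ = ∈-++⁺ʳ R₁ (there (∈-++⁺ʳ R₃ (here refl)))
          split₁ = ind-split (o₁ ∷ R₁) io₁R′
          split₃ = ind-split R₁ iRo₃′
          tail₃ : Ind ((r ∷ R₃) ++ r' ∷ (R₄ ++ [ o₃ ]))
          tail₃ = subst (λ L → Ind (r ∷ L)) (++-assoc R₃ (r' ∷ R₄) [ o₃ ]) (proj₁ (proj₂ split₃))
          split₄ = ind-split (r ∷ R₃) tail₃
          r#r' : r # r'
          r#r' = consec R₃ (proj₁ split₄)
            where
            consec : ∀ R₃ → Ind (r ∷ R₃ ++ [ r' ]) → r # r'
            -- With nothing between them, `r` and `r'` would form a triangle with `z`.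
            consec []      (cons e _ _) = contradiction (r , r' , z , e , sym G z~r' , sym G z~r) no-triangle
            consec (_ ∷ R₃) (cons _ f _) = f (∈-snoc R₃)
          z≢o₂ : z ≢ o₂
          -- The only neighbour of `o₂` in `K` is `k₂`, so `r` and `r'` would coincide.
          z≢o₂ refl = proj₁ r#r' (trans (Attached.only a₂ (inK r∈) z~r) (≡-sym (Attached.only a₂ (inK r'∈) z~r')))
          result′ : InducedK4Subdivision G
          result′ with last⇒snoc (last-tail (z≢o₂ ∘ ≡-sym) pZ)
          -- The legs are `R` up to `r`, `l` without its end `z`, and `R` from `r'` on; the vertices
          -- strictly between `r` and `r'` are discarded.
          ... | l' , refl = spider⇒K4 (sl (∈-snoc l'))
              (λ m → inK (sub₁ m)) (sl ∘ ∈-++⁺ˡ) (λ m → inK (sub₃ m))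
              (ind-snoc (proj₁ split₁) (last-snoc (o₁ ∷ R₁)) (sym G z~r) end₁-far) iZ
              (cons z~r' (#*-++ R₄ z#R₄ λ { (here refl) → #-sym (not-on-R a₃ k₃∈R (∈-snoc l')) })
                (proj₁ (proj₂ split₄)))
              (λ u∈ v∈ → #-sym (farZ (there (∈-++⁺ˡ v∈)) (l'≢z v∈) (inR (sub₁ u∈))))
              R₁r⟂
              (λ u∈ v∈ → farZ (there (∈-++⁺ˡ u∈)) (l'≢z u∈) (inR (sub₃ v∈)))
              (not-on-R a₁ k₁∈R ∘ ∈-++⁺ˡ)
              (λ m → proj₂ (proj₂ split₁) (here refl) (∈-++⁺ʳ R₃ m))
              (λ m → farZ (here refl) (z≢o₂ ∘ ≡-sym) (inR (sub₁ m)))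
              (λ m → farZ (here refl) (z≢o₂ ∘ ≡-sym) (inR (sub₃ m)))
              o₃#R₁r
              (not-on-R a₃ k₃∈R ∘ ∈-++⁺ˡ)
            where
            sub₁ : ∀ {v} → v ∈ R₁ ++ [ r ] → v ∈ R₁ ++ r ∷ (R₃ ++ r' ∷ R₄)
            sub₁ m with ∈-snoc⁻ R₁ m
            ... | inj₁ m'   = ∈-++⁺ˡ m'
            ... | inj₂ refl = r∈
            sub₃ : ∀ {v} → v ∈ r' ∷ R₄ → v ∈ R₁ ++ r ∷ (R₃ ++ r' ∷ R₄)
            sub₃ m = ∈-++⁺ʳ R₁ (there (∈-++⁺ʳ R₃ m))
            l'≢z : ∀ {v} → v ∈ l' → v ≢ z
            l'≢z m refl = proj₂ (ind-inner l' (ind-tail iZ)) m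
            end₁-far : ∀ {v} → v ∈ o₁ ∷ R₁ ++ [ r ] → v ≢ r → v # z
            end₁-far (here refl) ne = not-on-R a₁ k₁∈R (∈-snoc l')
            end₁-far (there m) ne with ∈-snoc⁻ R₁ m
            ... | inj₁ m'   = #-sym (z#R₁ m')
            ... | inj₂ refl = contradiction refl ne
            R₁r⟂ : (R₁ ++ [ r ]) ⟂ (r' ∷ R₄)
            R₁r⟂ u∈ v∈ with ∈-snoc⁻ R₁ u∈
            ... | inj₁ u∈R₁ = proj₂ (proj₂ split₁) (there u∈R₁) (∈-++⁺ʳ R₃ v∈)
            R₁r⟂ u∈ (here refl) | inj₂ refl = r#r'
            R₁r⟂ u∈ (there m)   | inj₂ refl = proj₂ (proj₂ split₄) (here refl) (∈-++⁺ˡ m)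
            o₃#R₁r : o₃ #* (R₁ ++ [ r ])
            o₃#R₁r m with ∈-snoc⁻ R₁ m
            ... | inj₁ m'   = #-sym (proj₂ (proj₂ split₃) m' (∈-snoc (R₃ ++ r' ∷ R₄)))
            ... | inj₂ refl = #-sym (proj₂ (proj₂ split₄) (here refl) (∈-snoc R₄))

-- Breadth-first layering of the components.

least : ∀ {P : ℕ → Set} → (∀ k → Dec (P k)) → ∀ {m} → P m → ∃[ k ] P k × (∀ {j} → P j → k ≤ j)
least P? {zero}  p = 0 , p , λ _ → z≤n
least P? {suc m} p with P? 0
... | yes p₀ = 0 , p₀ , λ _ → z≤n
... | no ¬p₀ with k , q , min ← least (P? ∘ suc) p =
  suc k , q , λ { {zero} p₀ → contradiction p₀ ¬p₀ ; {suc j} pj → s≤s (min pj) }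

leastFin : ∀ {n} {P : Fin n → Set} → (∀ x → Dec (P x)) → ∀ {x} → P x →
           ∃[ y ] P y × (∀ {z} → P z → toℕ y ≤ toℕ z)
leastFin {suc n} P? {x} p with P? zero
... | yes p₀ = zero , p₀ , λ _ → z≤n
leastFin P? {zero}  p | no ¬p₀ = contradiction p ¬p₀
leastFin P? {suc x} p | no ¬p₀ with y , q , min ← leastFin (P? ∘ suc) p =
  suc y , q , λ { {zero} p₀ → contradiction p₀ ¬p₀ ; {suc z} pz → s≤s (min pz) }

unique-lookup : ∀ {A : Set} {xs : List A} → Unique xs → ∀ {i j} → lookup xs i ≡ lookup xs j → i ≡ j
unique-lookup (ps ∷ us) {zero}  {zero}  eq = refl
unique-lookup (ps ∷ us) {zero}  {suc j} eq = contradiction eq (All.lookup ps (∈-lookup j))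
unique-lookup (ps ∷ us) {suc i} {zero}  eq = contradiction (≡-sym eq) (All.lookup ps (∈-lookup i))
unique-lookup (ps ∷ us) {suc i} {suc j} eq = cong suc (unique-lookup us eq)

-- The distance to a root enters later arguments through these properties alone, so one record
-- serves both `G` and the graph of the edges inside its layers. By symmetry of adjacency `level-~`
-- bounds the difference of levels in both directions.
record Layering {n} (G : Graph n) : Set where
  field
    level   : Fin n → ℕ
    root    : Fin n → Fin n
    level-~ : ∀ {u v} → Adj G u v → level v ≤ suc (level u)
    parent  : ∀ {v k} → level v ≡ suc k → ∃[ w ] Adj G v w × level w ≡ k
    level-0 : ∀ {v} → level v ≡ 0 → v ≡ root v
    root-~  : ∀ {u v} → Adj G u v → root u ≡ root v

module BreadthFirst {n : ℕ} (G : Graph n) where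

  open InducedPaths G

  Reach : ℕ → V → V → Set
  Reach zero    v r = v ≡ r
  Reach (suc k) v r = ∃[ w ] v ~ w × Reach k w r

  reach? : ∀ k v r → Dec (Reach k v r)
  reach? zero    v r = v Fin.≟ r
  reach? (suc k) v r = Fin.any? λ w → (v ~? w) ×-dec reach? k w r

  reach⇒walk : ∀ k {v r} → Reach k v r → Walk (λ _ → ⊤) v r
  reach⇒walk zero    refl        = nil tt
  reach⇒walk (suc k) (w , e , p) = step tt e (reach⇒walk k p)

  path⇒reach : ∀ {v r l} → Ind (v ∷ l) → Last (v ∷ l) r → Reach (length l) v r
  path⇒reach [-] last = refl
  path⇒reach [-] (there ())
  path⇒reach (cons e _ i) (there p) = _ , e , path⇒reach i p

  -- The length is bounded by `n` so that a finite search decides connectedness.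
  Connected : V → V → Set
  Connected v r = ∃[ k ] Reach (toℕ {n} k) v r

  connected? : ∀ v r → Dec (Connected v r)
  connected? v r = Fin.any? λ k → reach? (toℕ k) v r

  -- A walk of any length shortens to an induced path, which repeats no vertex and so has fewer than
  -- `n` edges.
  connected : ∀ {k v r} → Reach k v r → Connected v r
  connected {k} p with l , i , q , _ ← walk⇒path (reach⇒walk k p) =
    fromℕ< short , subst (λ j → Reach j _ _) (≡-sym (Fin.toℕ-fromℕ< short)) (path⇒reach i q)
    where
    short : length l < n
    short = Fin.injective⇒≤ {f = lookup (_ ∷ l)} (unique-lookup (ind-unique i))

  layering : Layering G
  layering = record
    { level   = level
    ; root    = root
    ; level-~ = level-~
    ; parent  = parent
    ; level-0 = λ {v} eq → subst (λ k → Reach k v (root v)) eq (level-reach v)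
    ; root-~  = root-~
    }
    where
    -- The root of a component is its vertex of least index, hence the same for adjacent vertices.
    least-root : ∀ v → ∃[ r ] Connected v r × (∀ {s} → Connected v s → toℕ r ≤ toℕ s)
    least-root v = leastFin (connected? v) {v} (connected {0} refl)
    root : V → V
    root v = proj₁ (least-root v)
    root-conn : ∀ v → Connected v (root v)
    root-conn v = proj₁ (proj₂ (least-root v))
    root-min : ∀ v {s} → Connected v s → toℕ (root v) ≤ toℕ s
    root-min v = proj₂ (proj₂ (least-root v))
    conn-~ : ∀ {u v r} → u ~ v → Connected v r → Connected u r
    conn-~ e (k , p) = connected {suc (toℕ k)} (_ , e , p)
    root-~ : ∀ {u v} → u ~ v → root u ≡ root v
    root-~ {u} {v} e = Fin.toℕ-injective (ℕ.≤-antisym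
      (root-min u (conn-~ e (root-conn v))) (root-min v (conn-~ (sym G e) (root-conn u))))
    least-level : ∀ v → ∃[ k ] Reach k v (root v) × (∀ {j} → Reach j v (root v) → k ≤ j)
    least-level v = least (λ k → reach? k v (root v)) (proj₂ (root-conn v))
    level : V → ℕ
    level v = proj₁ (least-level v)
    level-reach : ∀ v → Reach (level v) v (root v)
    level-reach v = proj₁ (proj₂ (least-level v))
    level-min : ∀ v {j} → Reach j v (root v) → level v ≤ j
    level-min v = proj₂ (proj₂ (least-level v))
    level-~ : ∀ {u v} → u ~ v → level v ≤ suc (level u)
    level-~ {u} {v} e = level-min v (u , sym G e , subst (Reach (level u) u) (root-~ e) (level-reach u))
    parent : ∀ {v k} → level v ≡ suc k → ∃[ w ] v ~ w × level w ≡ k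
    parent {v} {k} eq with w , e , p ← subst (λ j → Reach j v (root v)) eq (level-reach v) =
      w , e , ℕ.≤-antisym (level-min w (subst (Reach k w) (root-~ e) p))
                          (s≤s⁻¹ (subst (_≤ suc (level w)) eq (level-~ (sym G e))))

third : ∀ (i j : Fin 3) → i ≢ j → ∃[ h ] h ≢ i × h ≢ j × (∀ x → x ≡ i ⊎ x ≡ j ⊎ x ≡ h)
third 0F 0F ne = contradiction refl ne
third 0F 1F ne = 2F , (λ ()) , (λ ()) , λ { 0F → inj₁ refl ; 1F → inj₂ (inj₁ refl) ; 2F → inj₂ (inj₂ refl) }
third 0F 2F ne = 1F , (λ ()) , (λ ()) , λ { 0F → inj₁ refl ; 2F → inj₂ (inj₁ refl) ; 1F → inj₂ (inj₂ refl) }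
third 1F 0F ne = 2F , (λ ()) , (λ ()) , λ { 1F → inj₁ refl ; 0F → inj₂ (inj₁ refl) ; 2F → inj₂ (inj₂ refl) }
third 1F 1F ne = contradiction refl ne
third 1F 2F ne = 0F , (λ ()) , (λ ()) , λ { 1F → inj₁ refl ; 2F → inj₂ (inj₁ refl) ; 0F → inj₂ (inj₂ refl) }
third 2F 0F ne = 1F , (λ ()) , (λ ()) , λ { 2F → inj₁ refl ; 0F → inj₂ (inj₁ refl) ; 1F → inj₂ (inj₂ refl) }
third 2F 1F ne = 0F , (λ ()) , (λ ()) , λ { 2F → inj₁ refl ; 1F → inj₂ (inj₁ refl) ; 0F → inj₂ (inj₂ refl) }
third 2F 2F ne = contradiction refl ne

-- Walks towards the root.

module LayeringProperties {n : ℕ} {G : Graph n} (L : Layering G) where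

  open InducedPaths G
  open Layering L

  level-apart : ∀ {k u v} → level u < k → k < level v → u # v
  level-apart lt gt = (λ { refl → ℕ.<-asym lt gt }) , λ e → ℕ.<-irrefl refl (ℕ.≤-trans gt (ℕ.≤-trans (level-~ e) lt))

  -- Parents are followed until level 0, which contains only the root of the component; every vertex
  -- after `v` has a smaller level than `v`.
  up-walk : ∀ {K : V → Set} {v} → K v → (∀ {w} → level w < level v → K w) → Walk K v (root v)
  up-walk {K} {v} = go (level v) refl
    where
    go : ∀ k {v} → level v ≡ k → K v → (∀ {w} → level w < level v → K w) → Walk K v (root v)
    go zero eq kv _ = subst (Walk K _) (level-0 eq) (nil kv)
    go (suc k) {v} eq kv below with w , e , eq' ← parent eq =
      subst (Walk K v) (≡-sym (root-~ e))
        (step kv e (go k eq' (below w<v) λ lt → below (ℕ.<-trans lt w<v)))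
      where
      w<v : level w < level v
      w<v rewrite eq | eq' = ℕ.≤-refl

  -- Both ends walk to their common root through smaller levels, and the resulting walk is
  -- shortened. An induced path does not return to its ends, so its interior lies in the smaller
  -- levels.
  link : ∀ {a b k} → a ≢ b → level a ≡ k → level b ≡ k → root a ≡ root b →
         ∃[ Z ] Ind (a ∷ Z ++ [ b ]) × (∀ {v} → v ∈ Z → level v < k)
  link {a} {b} {k} a≢b refl eqb r = Z , i , λ m → [ (λ { refl → contradiction (∈-++⁺ˡ m) (ind-∉ i) }) ,
      [ (λ { refl → contradiction m (proj₂ (ind-inner Z (ind-tail i))) }) , id ]′ ]′ (s m)
    where
    K : V → Set
    K v = v ≡ a ⊎ v ≡ b ⊎ level v < k
    path = walk⇒path′ {K = K} a≢b (up-walk (inj₁ refl) (inj₂ ∘ inj₂) ++ʷ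
      subst (λ x → Walk K x b) (≡-sym r)
        (walk-sym (up-walk (inj₂ (inj₁ refl)) λ {w} lt → inj₂ (inj₂ (subst (level w <_) eqb lt)))))
    Z = proj₁ path
    i = proj₁ (proj₂ path)
    s = proj₂ (proj₂ path)

-- Prolonging three paths towards the root until they meet.

module Layered {n : ℕ} (G : Graph n) (no-triangle : ¬ HasTriangle G) (no-K4 : ¬ InducedK4Subdivision G)
               (L : Layering G) where

  open InducedPaths G
  open K4 G
  open Layering L
  open LayeringProperties L

  triangle : ∀ {u v w} → u ~ v → v ~ w → ¬ (u ~ w)
  triangle e f g = no-triangle (_ , _ , _ , e , f , g)

  -- The neighbour of `y` on the leg is `γ` itself when `l` is empty; both cases are brought to the
  -- shape that `fan` asks for.
  leg-start : ∀ {y} l {γ} → Ind (y ∷ l ++ [ γ ]) →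
    ∃[ f ] f ∈ l ++ [ γ ] × y ~ f × (∀ {v} → v ∈ l ++ [ γ ] → y ~ v → v ≡ f) ×
      (∀ {K : V → Set} → (∀ {u} → u ∈ l ++ [ γ ] → K u) → ∀ {v} → v ∈ l ++ [ γ ] → Walk K f v)
  leg-start []      {γ} i@(cons e _ j) = γ , here refl , e , ind-second i , λ s → path-walk j s
  leg-start (x ∷ l) i@(cons e _ j) = x , here refl , e , ind-second i , λ s → path-walk j s

  -- Three paths from y, of interiors l i, ending at distinct (possibly adjacent) vertices α i of layer k,
  -- everything else lying farther from the root than layer k.
  record Spider (y : V) (k : ℕ) (l : Fin 3 → List V) (α : Fin 3 → V) : Set where
    field
      ind   : ∀ i → Ind (y ∷ l i ++ [ α i ])
      far   : ∀ {i j} → i ≢ j → l i ⟂ l j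
      off   : ∀ {i j} → i ≢ j → α i #* l j
      dist  : ∀ {i j} → i ≢ j → α i ≢ α j
      low   : ∀ i {v} → v ∈ l i → k < level v
      low-y : k < level y
      lev   : ∀ i → level (α i) ≡ k
      rooted : ∀ i → root (α i) ≡ root y

  -- An induced theta with ends `y` and `t`, whose three paths prolong the legs of a `Spider` beyond
  -- the vertices `α i`.
  record Theta (y : V) (k : ℕ) (l : Fin 3 → List V) (α : Fin 3 → V) : Set where
    field
      t       : V
      m       : Fin 3 → List V
      t-level : level t < k
      m-level : ∀ i {v} → v ∈ m i → level v < k
      ind     : ∀ i → Ind (y ∷ (l i ++ α i ∷ m i) ++ [ t ])
      far     : ∀ {i j} → i ≢ j → (l i ++ α i ∷ m i) ⟂ (l j ++ α j ∷ m j)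

  module Climb {y k l α} (S : Spider y (suc k) l α) where

    open Spider S

    α-apart-level : ∀ i {v} → level v < k → α i # v
    α-apart-level i lt = #-sym (level-apart lt (subst (k <_) (≡-sym (lev i)) ℕ.≤-refl))

    up-apart-l : ∀ i {u v} → level u ≤ k → v ∈ l i → u # v
    up-apart-l i le v∈ = level-apart (s≤s le) (low i v∈)

    up-≢α : ∀ i {v} → level v ≤ k → α i ≢ v
    up-≢α i le refl = ℕ.<-irrefl (lev i) (s≤s le)

    y-apart-up : ∀ {v} → level v ≤ k → y # v
    y-apart-up le = #-sym (level-apart (s≤s le) low-y)

    leg⟂l : ∀ {i h} → h ≢ i → (l h ++ [ α h ]) ⟂ l i
    leg⟂l {i} {h} ne u∈ v∈ with ∈-snoc⁻ (l h) u∈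
    ... | inj₁ u∈l  = far ne u∈l v∈
    ... | inj₂ refl = off ne v∈

    extend : ∀ i {zs} → Ind (α i ∷ zs) → (∀ {v} → v ∈ zs → level v ≤ k) → Ind (y ∷ l i ++ α i ∷ zs)
    extend i j up = ind-join (y ∷ l i) (ind i) j λ
      { (here refl) v∈ → y-apart-up (up v∈) ; (there u∈) v∈ → #-sym (up-apart-l i (up v∈) u∈) }

    module Edge {i j h} (i≢j : i ≢ j) (h≢i : h ≢ i) (h≢j : h ≢ j) (e : α i ~ α j) where

      γ' : V
      γ' = proj₁ (parent (lev h))

      γ~γ' : α h ~ γ'
      γ~γ' = proj₁ (proj₂ (parent (lev h)))

      γ'-level : level γ' ≡ k
      γ'-level = proj₂ (proj₂ (parent (lev h)))

      -- One neighbour of α x for the fan; it must be α h or γ' when α x sees one of them, since both lie in K.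
      pick : ∀ x → ∃[ w ] α x ~ w × (w ≡ α h ⊎ level w ≡ k) × (α x ~ α h → α h ≡ w) × (α x ~ γ' → γ' ≡ w)
      pick x with α x ~? α h
      ... | yes a = α h , a , inj₁ refl , (λ _ → refl) , λ b → contradiction b (triangle a γ~γ')
      ... | no ¬a with α x ~? γ'
      ...   | yes b = γ' , b , inj₂ γ'-level , (λ a → contradiction a ¬a) , λ _ → refl
      ...   | no ¬b with w , a , eq ← parent (lev x) =
        w , a , inj₂ eq , (λ a → contradiction a ¬a) , λ b → contradiction b ¬b

      wi wj : V
      wi = proj₁ (pick i)
      wj = proj₁ (pick j)

      -- From level `k` this drops all neighbours of `α i` except `wi` and all neighbours of `α j`
      -- except `wj`. Smaller levels contain no neighbours of these two, so each is left with a
      -- single neighbour in `K`.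
      Up : V → Set
      Up v = level v ≤ k × (α i ~ v → v ≡ wi) × (α j ~ v → v ≡ wj)

      K : V → Set
      K v = v ∈ l h ++ [ α h ] ⊎ Up v

      below : ∀ {v} → level v < k → K v
      below lt = inj₂ (ℕ.<⇒≤ lt , (λ a → contradiction a (proj₂ (α-apart-level i lt))) ,
                                   λ a → contradiction a (proj₂ (α-apart-level j lt)))

      γ'∈K : K γ'
      γ'∈K = inj₂ (ℕ.≤-reflexive γ'-level , proj₂ (proj₂ (proj₂ (proj₂ (pick i)))) ,
                                             proj₂ (proj₂ (proj₂ (proj₂ (pick j)))))

      K⟂ : ∀ {x} → h ≢ x → ∀ {v} → K v → v #* l x
      K⟂ ne (inj₁ m) = leg⟂l ne m
      K⟂ {x} ne (inj₂ (le , _)) = up-apart-l x le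

      wi∈K : K wi
      wi∈K with proj₁ (proj₂ (proj₂ (pick i)))
      ... | inj₁ eq = inj₁ (subst (_∈ l h ++ [ α h ]) (≡-sym eq) (∈-snoc (l h)))
      -- As `α i` and `α j` are adjacent, `wi` cannot be a neighbour of `α j` as well.
      ... | inj₂ eq = inj₂ (ℕ.≤-reflexive eq , (λ _ → refl) , λ a → contradiction a (triangle (sym G e) (proj₁ (proj₂ (pick i)))))

      wj∈K : K wj
      wj∈K with proj₁ (proj₂ (proj₂ (pick j)))
      ... | inj₁ eq = inj₁ (subst (_∈ l h ++ [ α h ]) (≡-sym eq) (∈-snoc (l h)))
      ... | inj₂ eq = inj₂ (ℕ.≤-reflexive eq , (λ a → contradiction a (triangle e (proj₁ (proj₂ (pick j))))) , λ _ → refl)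

      γ-walk : Walk K (α h) (root y)
      γ-walk = step (inj₁ (∈-snoc (l h))) γ~γ' (subst (Walk K γ')
        (trans (≡-sym (root-~ γ~γ')) (rooted h)) (up-walk γ'∈K (below ∘ subst (_ <_) γ'-level)))

      w-walk : ∀ x → K (proj₁ (pick x)) → Walk K (proj₁ (pick x)) (root y)
      w-walk x k∈ with pick x
      ... | w , a , inj₁ refl , _ = γ-walk
      ... | w , a , inj₂ eq , _ = subst (Walk K w) (trans (≡-sym (root-~ a)) (rooted x))
                                   (up-walk k∈ (below ∘ subst (_ <_) eq))

      attached-α : ∀ x → h ≢ x → K (proj₁ (pick x)) → (∀ {v} → Up v → α x ~ v → v ≡ proj₁ (pick x)) →
                   Attached (α x) K (proj₁ (pick x))
      attached-α x ne k∈ only = attached k∈ (proj₁ (proj₂ (pick x))) out only′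
        where
        out : ∀ {v} → K v → α x ≢ v
        out (inj₁ m) with ∈-snoc⁻ (l h) m
        ... | inj₁ m'   = proj₁ (off (ne ∘ ≡-sym) m')
        ... | inj₂ refl = dist (ne ∘ ≡-sym)
        out (inj₂ (le , _)) = up-≢α x le
        only′ : ∀ {v} → K v → α x ~ v → v ≡ proj₁ (pick x)
        only′ (inj₁ m) a with ∈-snoc⁻ (l h) m
        ... | inj₁ m'   = contradiction a (proj₂ (off (ne ∘ ≡-sym) m'))
        ... | inj₂ refl = proj₁ (proj₂ (proj₂ (proj₂ (pick x)))) a
        only′ (inj₂ u) a = only u a

      -- Legs `i` and `j` with the edge between their ends form a hole. The set `K` touches it at
      -- `y` through the third leg, at `α i` by `wi` and at `α j` by `wj`, and it is connected
      -- through the root.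
      impossible : ⊥
      impossible with f , f∈ , y~f , only-f , walks ← leg-start (l h) (ind h) =
        no-K4 (fan hole (K⟂ h≢i) (K⟂ h≢j) (λ _ ()) no-triangle
          (attached (inj₁ f∈) y~f out λ { (inj₁ m) a → only-f m a
                                        ; (inj₂ (le , _)) a → contradiction a (proj₂ (y-apart-up le)) })
          (attached-α i h≢i wi∈K (proj₁ ∘ proj₂)) (attached-α j h≢j wj∈K (proj₂ ∘ proj₂))
          ((walks inj₁ (∈-snoc (l h)) ++ʷ γ-walk) ++ʷ walk-sym (w-walk j wj∈K))
          (w-walk i wi∈K ++ʷ walk-sym (w-walk j wj∈K)))
        where
        out : ∀ {v} → K v → y ≢ v
        out (inj₁ m) refl = ind-∉ (ind h) m
        out (inj₂ (le , _)) = proj₁ (y-apart-up le)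
        hole : Hole y (α i) (α j) (l i) (l j) []
        hole = record
          { ind₁₂ = ind i ; ind₁₃ = ind j ; ind₂₃ = edge e ; A⟂B = far i≢j ; A⟂D = λ _ () ; B⟂D = λ _ ()
          ; off₁ = λ () ; off₂ = off i≢j ; off₃ = off (i≢j ∘ ≡-sym) }

    module NoEdge (α-apart : ∀ {i j} → i ≢ j → α i # α j) where

      leg⟂α : ∀ {i h} → h ≢ i → α i #* (l h ++ [ α h ])
      leg⟂α {i} {h} ne v∈ with ∈-snoc⁻ (l h) v∈
      ... | inj₁ v∈l  = off (ne ∘ ≡-sym) v∈l
      ... | inj₂ refl = α-apart (ne ∘ ≡-sym)

      -- The continuations `m i` lie too close to the root to touch `y` or any `l j`, so only
      -- relations among the continuations and the ends `α i` have to be supplied.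
      theta : ∀ {t} m → level t ≡ k → (∀ i {v} → v ∈ m i → level v ≤ k) → (∀ i → Ind (α i ∷ m i ++ [ t ])) →
              (∀ {i j} → i ≢ j → m i ⟂ m j) → (∀ {i j} → i ≢ j → α i #* m j) → Theta y (suc k) l α
      theta {t} m eq up ind-m m⟂m α#m = record
        { t = t ; m = m ; t-level = s≤s (ℕ.≤-reflexive eq) ; m-level = λ i v∈ → s≤s (up i v∈)
        ; ind = λ i → subst (λ L → Ind (y ∷ L)) (≡-sym (++-assoc (l i) (α i ∷ m i) [ t ]))
            (extend i (ind-m i) λ v∈ → [ up i , (λ { refl → ℕ.≤-reflexive eq }) ]′ (∈-snoc⁻ (m i) v∈))
        ; far = λ {i} {j} ne u∈ v∈ → go ne (view i u∈) (view j v∈) }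
        where
        view : ∀ i {v} → v ∈ l i ++ α i ∷ m i → v ∈ l i ⊎ v ≡ α i ⊎ v ∈ m i
        view i v∈ with ∈-++⁻ (l i) v∈
        ... | inj₁ p         = inj₁ p
        ... | inj₂ (here eq) = inj₂ (inj₁ eq)
        ... | inj₂ (there p) = inj₂ (inj₂ p)
        go : ∀ {i j u v} → i ≢ j → u ∈ l i ⊎ u ≡ α i ⊎ u ∈ m i → v ∈ l j ⊎ v ≡ α j ⊎ v ∈ m j → u # v
        go ne (inj₁ p)           (inj₁ q)           = far ne p q
        go ne (inj₁ p)           (inj₂ (inj₁ refl)) = #-sym (off (ne ∘ ≡-sym) p)
        go {i} {j} ne (inj₁ p)   (inj₂ (inj₂ q))    = #-sym (up-apart-l i (up j q) p)
        go ne (inj₂ (inj₁ refl)) (inj₁ q)           = off ne q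
        go ne (inj₂ (inj₁ refl)) (inj₂ (inj₁ refl)) = α-apart ne
        go ne (inj₂ (inj₁ refl)) (inj₂ (inj₂ q))    = α#m ne q
        go {i} {j} ne (inj₂ (inj₂ p)) (inj₁ q)      = up-apart-l j (up i p) q
        go ne (inj₂ (inj₂ p))    (inj₂ (inj₁ refl)) = #-sym (α#m (ne ∘ ≡-sym) p)
        go ne (inj₂ (inj₂ p))    (inj₂ (inj₂ q))    = m⟂m ne p q

      common-parent : ∀ {w} → level w ≡ k → (∀ x → α x ~ w) → Theta y (suc k) l α
      common-parent eq a = theta (λ _ → []) eq (λ _ ()) (λ i → edge (a i)) (λ _ ()) (λ _ ())

      module Two {i j h w w'} (i≢j : i ≢ j) (h≢i : h ≢ i) (h≢j : h ≢ j)
                 (cover : ∀ x → x ≡ i ⊎ x ≡ j ⊎ x ≡ h)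
                 (w-level : level w ≡ k) (w'-level : level w' ≡ k)
                 (i~w : α i ~ w) (j~w : α j ~ w) (h≁w : ¬ (α h ~ w)) (h~w' : α h ~ w') where

        w'≢w : w' ≢ w
        w'≢w refl = h≁w h~w'

        private
          linked = link w'≢w w'-level w-level
            (trans (≡-sym (root-~ h~w')) (trans (rooted h) (trans (≡-sym (rooted i)) (root-~ i~w))))

        Z : List V
        Z = proj₁ linked

        indZ : Ind (w' ∷ Z ++ [ w ])
        indZ = proj₁ (proj₂ linked)

        Z-level : ∀ {v} → v ∈ Z → level v < k
        Z-level = proj₂ (proj₂ linked)

        w'Z-level : ∀ {v} → v ∈ w' ∷ Z → level v ≤ k
        w'Z-level (here refl) = ℕ.≤-reflexive w'-level
        w'Z-level (there v∈)  = ℕ.<⇒≤ (Z-level v∈)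

        α#w'Z : ∀ {x} → ¬ (α x ~ w') → α x #* (w' ∷ Z)
        α#w'Z {x} x≁w' = #*-∷ (up-≢α x (ℕ.≤-reflexive w'-level) , x≁w') (α-apart-level x ∘ Z-level)

        -- The paths meet in `w`: legs `i` and `j` reach it directly, leg `h` through `w'` and `Z`.
        w~α⇒theta : ¬ (α i ~ w') → ¬ (α j ~ w') → Theta y (suc k) l α
        w~α⇒theta i≁w' j≁w' = theta m w-level up ind-m m⟂m α#m
          where
          m : Fin 3 → List V
          m x with x Fin.≟ h
          ... | yes _ = w' ∷ Z
          ... | no _  = []
          up : ∀ x {v} → v ∈ m x → level v ≤ k
          up x v∈ with x Fin.≟ h
          up x v∈ | yes _ = w'Z-level v∈
          ind-m : ∀ x → Ind (α x ∷ m x ++ [ w ])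
          ind-m x with x Fin.≟ h
          ... | yes refl = cons h~w' (#*-++ Z (α-apart-level h ∘ Z-level)
                             λ { (here refl) → up-≢α h (ℕ.≤-reflexive w-level) , h≁w }) indZ
          ... | no ne with cover x
          ...   | inj₁ refl        = edge i~w
          ...   | inj₂ (inj₁ refl) = edge j~w
          ...   | inj₂ (inj₂ eq)   = contradiction eq ne
          m⟂m : ∀ {x z} → x ≢ z → m x ⟂ m z
          m⟂m {x} {z} ne u∈ v∈ with x Fin.≟ h | z Fin.≟ h
          ... | yes refl | yes refl = contradiction refl ne
          m⟂m ne u∈ () | yes _ | no _
          m⟂m ne () v∈ | no _ | _
          α#m : ∀ {x z} → x ≢ z → α x #* m z
          α#m {x} {z} ne v∈ with z Fin.≟ h
          α#m {x} {z} ne () | no _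
          α#m {x} {z} ne v∈ | yes refl with cover x
          ... | inj₁ refl        = α#w'Z i≁w' v∈
          ... | inj₂ (inj₁ refl) = α#w'Z j≁w' v∈
          ... | inj₂ (inj₂ eq)   = contradiction eq ne

        -- Legs `i` and `j` close a hole through `w`. Leg `h` continued by `w'` and `Z` touches it
        -- exactly at `y`, at `w` and, because `α j` sees `w'`, at `α j`.
        crossing-impossible : ¬ (α i ~ w') → α j ~ w' → ⊥
        crossing-impossible i≁w' j~w'
          with f , f∈ , y~f , only-f , walks ← leg-start (l h) (ind h)
          with z , pz ← ∃-last w' Z =
          no-K4 (fan hole
            (λ k∈ v∈ → [ K⟂l h≢i k∈ , (λ { refl → #-sym (K#α k∈) }) ]′ (∈-snoc⁻ (l i) v∈))
            (K⟂l h≢j) (λ _ ()) no-triangle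
            (attached (inj₁ f∈) y~f out-y λ { (inj₁ m) a → only-f m a
                                            ; (inj₂ m) a → contradiction a (proj₂ (y-apart-up (w'Z-level m))) })
            (attached (inj₂ (last-∈ pz)) (ind-last-~ indZ pz)
              (λ { (inj₁ m) → proj₁ (w#leg m) ; (inj₂ m) refl → proj₂ (ind-inner (w' ∷ Z) indZ) m })
              λ { (inj₁ m) a → contradiction a (proj₂ (w#leg m)) ; (inj₂ m) a → ind-last indZ pz m a })
            (attached (inj₂ (here refl)) j~w'
              (λ { (inj₁ m) → proj₁ (leg⟂α h≢j m) ; (inj₂ m) → up-≢α j (w'Z-level m) })
              λ { (inj₁ m) a → contradiction a (proj₂ (leg⟂α h≢j m)) ; (inj₂ (here eq)) _ → eq
                ; (inj₂ (there m)) a → contradiction a (proj₂ (α-apart-level j (Z-level m))) })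
            (walks inj₁ (∈-snoc (l h)) ++ʷ step (inj₁ (∈-snoc (l h))) h~w' (nil (inj₂ (here refl))))
            (walk-sym (path-walk (proj₁ (ind-inner (w' ∷ Z) indZ)) inj₂ (last-∈ pz))))
          where
          K : V → Set
          K v = v ∈ l h ++ [ α h ] ⊎ v ∈ w' ∷ Z
          K⟂l : ∀ {x} → h ≢ x → ∀ {v} → K v → v #* l x
          K⟂l ne (inj₁ m) = leg⟂l ne m
          K⟂l {x} ne (inj₂ m) = up-apart-l x (w'Z-level m)
          K#α : ∀ {v} → K v → α i # v
          K#α (inj₁ m) = leg⟂α h≢i m
          K#α (inj₂ m) = α#w'Z i≁w' m
          w-up : level w ≤ k
          w-up = ℕ.≤-reflexive w-level
          w#leg : w #* (l h ++ [ α h ])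
          w#leg m with ∈-snoc⁻ (l h) m
          ... | inj₁ m'   = up-apart-l h w-up m'
          ... | inj₂ refl = #-sym (up-≢α h w-up , h≁w)
          out-y : ∀ {v} → K v → y ≢ v
          out-y (inj₁ m) refl = ind-∉ (ind h) m
          out-y (inj₂ m) = proj₁ (y-apart-up (w'Z-level m))
          hole : Hole y w (α j) (l i ++ [ α i ]) (l j) []
          hole = record
            { ind₁₂ = subst (λ L → Ind (y ∷ L)) (≡-sym (++-assoc (l i) [ α i ] [ w ]))
                        (extend i (edge i~w) λ { (here refl) → w-up })
            ; ind₁₃ = ind j ; ind₂₃ = edge (sym G j~w) ; A⟂B = leg⟂l i≢j ; A⟂D = λ _ () ; B⟂D = λ _ ()
            ; off₁ = λ () ; off₂ = up-apart-l j w-up ; off₃ = leg⟂α i≢j }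

      par : Fin 3 → V
      par i = proj₁ (parent (lev i))

      α~par : ∀ i → α i ~ par i
      α~par i = proj₁ (proj₂ (parent (lev i)))

      par-level : ∀ i → level (par i) ≡ k
      par-level i = proj₂ (proj₂ (parent (lev i)))

      -- If the third end does not see the shared parent, it brings a parent of its own. When both
      -- or neither of the first two ends see that one, the paths meet; when exactly one does,
      -- `crossing-impossible` applies.
      shared-parent : ∀ {i j} → i ≢ j → α j ~ par i → Theta y (suc k) l α
      shared-parent {i} {j} i≢j j~w with third i j i≢j
      ... | h , h≢i , h≢j , cover with α h ~? par i
      ...   | yes h~w = common-parent (par-level i) all
        where
        all : ∀ x → α x ~ par i
        all x with cover x
        ... | inj₁ refl        = α~par i
        ... | inj₂ (inj₁ refl) = j~w
        ... | inj₂ (inj₂ refl) = h~w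
      ...   | no h≁w with α i ~? par h | α j ~? par h
      ...     | no i≁w'  | no j≁w'  = Two.w~α⇒theta i≢j h≢i h≢j cover (par-level i) (par-level h) (α~par i) j~w h≁w (α~par h) i≁w' j≁w'
      ...     | no i≁w'  | yes j~w' = ⊥-elim (Two.crossing-impossible i≢j h≢i h≢j cover (par-level i) (par-level h)
                                        (α~par i) j~w h≁w (α~par h) i≁w' j~w')
      ...     | yes i~w' | no j≁w'  = ⊥-elim (Two.crossing-impossible (i≢j ∘ ≡-sym) h≢j h≢i cover′ (par-level i) (par-level h)
                                        j~w (α~par i) h≁w (α~par h) j≁w' i~w')
        where
        cover′ : ∀ x → x ≡ j ⊎ x ≡ i ⊎ x ≡ h
        cover′ x with cover x
        ... | inj₁ p        = inj₂ (inj₁ p)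
        ... | inj₂ (inj₁ p) = inj₁ p
        ... | inj₂ (inj₂ p) = inj₂ (inj₂ p)
      ...     | yes i~w' | yes j~w' = common-parent (par-level h) all
        where
        all : ∀ x → α x ~ par h
        all x with cover x
        ... | inj₁ refl        = i~w'
        ... | inj₂ (inj₁ refl) = j~w'
        ... | inj₂ (inj₂ refl) = α~par h

      module _ (no-shared : ∀ {i j} → i ≢ j → ¬ (α j ~ par i)) where

        -- The parents are distinct because none is shared. They may be adjacent, which a `Spider`
        -- permits and the next round of `climb` excludes.
        spider↑ : Spider y k (λ i → l i ++ [ α i ]) par
        spider↑ = record
          { ind = λ i → subst (λ L → Ind (y ∷ L)) (≡-sym (++-assoc (l i) [ α i ] [ par i ]))
                    (extend i (edge (α~par i)) λ { (here refl) → ℕ.≤-reflexive (par-level i) })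
          ; far = λ {i} {j} ne u∈ v∈ → [ leg⟂l ne u∈ , (λ { refl → #-sym (leg⟂α ne u∈) }) ]′ (∈-snoc⁻ (l j) v∈)
          ; off = λ {i} {j} ne v∈ → [ up-apart-l j (ℕ.≤-reflexive (par-level i)) ,
                    (λ { refl → #-sym (up-≢α j (ℕ.≤-reflexive (par-level i)) , no-shared ne) }) ]′ (∈-snoc⁻ (l j) v∈)
          ; dist = λ {i} {j} ne eq → no-shared ne (subst (α j ~_) (≡-sym eq) (α~par j))
          ; low = λ i v∈ → [ (λ v∈l → ℕ.<-trans ℕ.≤-refl (low i v∈l)) ,
                    (λ { refl → subst (k <_) (≡-sym (lev i)) ℕ.≤-refl }) ]′ (∈-snoc⁻ (l i) v∈)
          ; low-y = ℕ.<-trans ℕ.≤-refl low-y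
          ; lev = par-level
          ; rooted = λ i → trans (≡-sym (root-~ (α~par i))) (rooted i)
          }

        descend : Theta y k (λ i → l i ++ [ α i ]) par → Theta y (suc k) l α
        descend T = record
          { t = t ; m = λ i → par i ∷ m i ; t-level = ℕ.m<n⇒m<1+n t-level
          ; m-level = λ { i (here refl) → s≤s (ℕ.≤-reflexive (par-level i))
                        ; i (there v∈)  → ℕ.m<n⇒m<1+n (m-level i v∈) }
          ; ind = λ i → subst (λ L → Ind (y ∷ L ++ [ t ])) (eq i) (ind-T i)
          ; far = λ {i} {j} ne u∈ v∈ → far-T ne (subst (_ ∈_) (≡-sym (eq i)) u∈) (subst (_ ∈_) (≡-sym (eq j)) v∈)
          }
          where
          open Theta T renaming (ind to ind-T; far to far-T)
          eq : ∀ i → (l i ++ [ α i ]) ++ par i ∷ m i ≡ l i ++ α i ∷ par i ∷ m i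
          eq i = ++-assoc (l i) [ α i ] (par i ∷ m i)

  -- Induction on the level of the ends: adjacent ends are impossible, a shared parent finishes the
  -- climb, and otherwise the parents are the ends of a longer spider.
  climb : ∀ {y k l α} → Spider y k l α → Theta y k l α
  -- At level 0 every end would be the root of the component, but the ends are distinct.
  climb {k = zero} S = contradiction
    (trans (level-0 (lev 0F)) (trans (trans (rooted 0F) (≡-sym (rooted 1F))) (≡-sym (level-0 (lev 1F)))))
    (dist λ ())
    where open Spider S
  climb {y} {suc k} {l} {α} S with Fin.any? (λ i → Fin.any? λ j → ¬? (i Fin.≟ j) ×-dec (α i ~? α j))
  ... | yes (i , j , i≢j , e) with h , h≢i , h≢j , _ ← third i j i≢j =
    ⊥-elim (Climb.Edge.impossible S i≢j h≢i h≢j e)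
  ... | no ¬e = no-edges
    where
    open Spider S
    open Climb S
    α-apart : ∀ {i j} → i ≢ j → α i # α j
    α-apart ne = dist ne , λ e → ¬e (_ , _ , ne , e)
    open NoEdge α-apart
    no-edges : Theta y (suc k) l α
    no-edges with Fin.any? (λ i → Fin.any? λ j → ¬? (i Fin.≟ j) ×-dec (α j ~? par i))
    ... | yes (i , j , i≢j , e) = shared-parent i≢j e
    ... | no ¬s = descend ns (climb (spider↑ ns))
      where
      ns : ∀ {i j} → i ≢ j → ¬ (α j ~ par i)
      ns {i} {j} ne e = ¬s (i , j , ne , e)

-- No layer contains an induced cycle of length at least five.

module NoLongHole {n : ℕ} (G : Graph n) (no-triangle : ¬ HasTriangle G) (no-K4 : ¬ InducedK4Subdivision G)
               (L : Layering G) where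

  open InducedPaths G
  open K4 G
  open Layering L
  open LayeringProperties L
  open Layered G no-triangle no-K4 L

  apart-below : ∀ {k u v} → level u ≡ suc k → level v < k → u # v
  apart-below {k} eq lt = #-sym (level-apart lt (subst (k <_) (≡-sym eq) ℕ.≤-refl))

  parent-≢ : ∀ {k u v} → level u ≡ suc k → level v ≡ k → u ≢ v
  parent-≢ eq eq' refl = ℕ.1+n≢n (trans (≡-sym eq) eq')

  -- The hole is the 4-cycle `y`, `c`, `q`, `d`. The set formed by `e`, `r` and a path from `r`
  -- towards `q` through smaller levels touches it at `y` by `r`, at `d` by `e` and at `q` by the
  -- end of the path.
  shared-parents-impossible : ∀ {k c y d e q r} → level c ≡ suc k → level y ≡ suc k → level d ≡ suc k → level e ≡ suc k →
    level q ≡ k → level r ≡ k → c ~ y → y ~ d → d ~ e → c # e → y ≢ e → c ≢ d →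
    c ~ q → d ~ q → y ~ r → e ~ r → ⊥
  shared-parents-impossible {k} {c} {y} {d} {e} {q} {r} lc ly ld le lq lr c~y y~d d~e c#e y≢e c≢d c~q d~q y~r e~r
    with Z , indZ , Z-level ← link {r} {q} (λ { refl → triangle c~y y~r c~q }) lr lq
           (trans (≡-sym (root-~ y~r)) (trans (root-~ y~d) (root-~ d~q)))
    with z , pz ← ∃-last r Z =
    no-K4 (fan hole {K = K} K#c (λ _ ()) (λ _ ()) no-triangle
      (attached (inj₂ (here refl)) y~r
        (λ { (inj₁ refl) → y≢e ; (inj₂ (here refl)) → parent-≢ ly lr ; (inj₂ (there m)) → proj₁ (apart-below ly (Z-level m)) })
        λ { (inj₁ refl) a → contradiction a (triangle y~d d~e) ; (inj₂ (here eq)) _ → eq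
          ; (inj₂ (there m)) a → contradiction a (proj₂ (apart-below ly (Z-level m))) })
      (attached (inj₂ (last-∈ pz)) (ind-last-~ indZ pz)
        (λ { (inj₁ refl) eq → parent-≢ le lq (≡-sym eq) ; (inj₂ m) refl → proj₂ (ind-inner (r ∷ Z) indZ) m })
        λ { (inj₁ refl) a → contradiction a (triangle (sym G d~q) d~e) ; (inj₂ m) a → ind-last indZ pz m a })
      (attached (inj₁ refl) d~e
        (λ { (inj₁ refl) → ~⇒≢ d~e ; (inj₂ (here refl)) → parent-≢ ld lr ; (inj₂ (there m)) → proj₁ (apart-below ld (Z-level m)) })
        λ { (inj₁ eq) _ → eq ; (inj₂ (here refl)) a → contradiction a (triangle (sym G y~d) y~r)
          ; (inj₂ (there m)) a → contradiction a (proj₂ (apart-below ld (Z-level m))) })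
      (step (inj₂ (here refl)) (sym G e~r) (nil (inj₁ refl)))
      (walk-sym (path-walk (proj₁ (ind-inner (r ∷ Z) indZ)) inj₂ (last-∈ pz)) ++ʷ
        step (inj₂ (here refl)) (sym G e~r) (nil (inj₁ refl))))
    where
    K : V → Set
    K v = v ≡ e ⊎ v ∈ r ∷ Z
    K#c : ∀ {v} → K v → v #* [ c ]
    K#c (inj₁ refl) (here refl) = #-sym c#e
    K#c (inj₂ (here refl)) (here refl) = #-sym (parent-≢ lc lr , triangle c~y y~r)
    K#c (inj₂ (there m)) (here refl) = #-sym (apart-below lc (Z-level m))
    hole : Hole y q d [ c ] [] []
    hole = record
      { ind₁₂ = cons (sym G c~y) (λ { (here refl) → parent-≢ ly lq , triangle (sym G c~y) c~q }) (edge c~q)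
      ; ind₁₃ = edge y~d ; ind₂₃ = edge (sym G d~q)
      ; A⟂B = λ _ () ; A⟂D = λ _ () ; B⟂D = λ () ; off₁ = λ () ; off₂ = λ ()
      ; off₃ = λ { (here refl) → (c≢d ∘ ≡-sym) , λ d~c → triangle d~c c~y (sym G y~d) } }

  -- Here `c`, `y`, `d` are consecutive on the cycle, and `xs` is the rest of it, read from `c` to
  -- `d`. In the spider below index 0 is the side of `c`, 1 that of `p` and 2 that of `d`.
  module PrivateParents {k c y d p q r xs}
    (lc : level c ≡ suc k) (ly : level y ≡ suc k) (ld : level d ≡ suc k) (lxs : ∀ {v} → v ∈ xs → level v ≡ suc k)
    (lp : level p ≡ k) (lq : level q ≡ k) (lr : level r ≡ k)
    (y~c : y ~ c) (y~d : y ~ d) (rest : Ind (c ∷ xs ++ [ d ])) (y#xs : y #* xs)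
    (y~p : y ~ p) (c~q : c ~ q) (d~r : d ~ r) (d≁q : ¬ (d ~ q)) (c≁r : ¬ (c ~ r)) where

    c#d : c # d
    c#d = ind-head-≢ xs rest , triangle (sym G y~c) y~d

    y#q : y # q
    y#q = parent-≢ ly lq , triangle y~c c~q

    y#r : y # r
    y#r = parent-≢ ly lr , triangle y~d d~r

    c#p : c # p
    c#p = parent-≢ lc lp , triangle (sym G y~c) y~p

    d#p : d # p
    d#p = parent-≢ ld lp , triangle (sym G y~d) y~p

    l : Fin 3 → List V
    l = lookup ([ c ] ∷ [] ∷ [ d ] ∷ [])

    α : Fin 3 → V
    α = lookup (q ∷ p ∷ r ∷ [])

    spider : Spider y k l α
    spider = record
      { ind = λ { 0F → cons y~c (λ { (here refl) → y#q }) (edge c~q) ; 1F → edge y~p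
                ; 2F → cons y~d (λ { (here refl) → y#r }) (edge d~r) }
      ; far = λ {i} {j} → far i j
      ; off = λ {i} {j} → off i j
      ; dist = λ {i} {j} → dist i j
      ; low = λ { 0F (here refl) → ℕ.≤-reflexive (≡-sym lc) ; 2F (here refl) → ℕ.≤-reflexive (≡-sym ld) }
      ; low-y = ℕ.≤-reflexive (≡-sym ly)
      ; lev = λ { 0F → lq ; 1F → lp ; 2F → lr }
      ; rooted = λ { 0F → ≡-sym (trans (root-~ y~c) (root-~ c~q)) ; 1F → ≡-sym (root-~ y~p)
                   ; 2F → ≡-sym (trans (root-~ y~d) (root-~ d~r)) }
      }
      where
      far : ∀ i j → i ≢ j → l i ⟂ l j
      far 0F 0F ne = contradiction refl ne
      far 0F 1F ne _ ()
      far 0F 2F ne (here refl) (here refl) = c#d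
      far 1F _ ne ()
      far 2F 0F ne (here refl) (here refl) = #-sym c#d
      far 2F 1F ne _ ()
      far 2F 2F ne = contradiction refl ne
      off : ∀ i j → i ≢ j → α i #* l j
      off 0F 0F ne = contradiction refl ne
      off 0F 2F ne (here refl) = #-sym (parent-≢ ld lq , d≁q)
      off 1F 0F ne (here refl) = #-sym c#p
      off 1F 2F ne (here refl) = #-sym d#p
      off 2F 0F ne (here refl) = #-sym (parent-≢ lc lr , c≁r)
      off 2F 2F ne = contradiction refl ne
      off _ 1F ne ()
      q≢p : q ≢ p
      q≢p refl = proj₂ y#q y~p
      q≢r : q ≢ r
      q≢r refl = d≁q d~r
      p≢r : p ≢ r
      p≢r refl = proj₂ y#r y~p
      dist : ∀ i j → i ≢ j → α i ≢ α j
      dist 0F 0F ne = contradiction refl ne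
      dist 0F 1F ne = q≢p
      dist 0F 2F ne = q≢r
      dist 1F 0F ne = q≢p ∘ ≡-sym
      dist 1F 1F ne = contradiction refl ne
      dist 1F 2F ne = p≢r
      dist 2F 0F ne = q≢r ∘ ≡-sym
      dist 2F 1F ne = p≢r ∘ ≡-sym
      dist 2F 2F ne = contradiction refl ne

    open Theta (climb spider)

    leg : Fin 3 → List V
    leg i = l i ++ α i ∷ m i

    -- On legs 1 and 2 only `p`, `r` and `d` can be adjacent to a vertex of `xs`, since the rest of
    -- these legs has level below `k`.
    Hit : V → Set
    Hit v = v ~ p ⊎ v ~ r ⊎ v ~ d

    hit? : ∀ v → Dec (Hit v)
    hit? v = (v ~? p) ⊎-dec (v ~? r) ⊎-dec (v ~? d)

    -- The last vertex of `xs` sees `d`, and `xs` is not empty because `c` and `d` are not adjacent.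
    some-hit : Any Hit xs
    some-hit with z , pz ← ∃-last c xs with last-∈ pz
    ... | here refl = contradiction (sym G (ind-last-~ rest pz)) (proj₂ c#d)
    ... | there z∈  = lose z∈ (inj₂ (inj₂ (sym G (ind-last-~ rest pz))))

    z : V
    z = proj₁ (∃-last c (q ∷ m 0F))

    z-last : Last (leg 0F) z
    z-last = proj₂ (∃-last c (q ∷ m 0F))

    t#y : y # t
    t#y = apart-below ly t-level

    xs-≢d : ∀ {v} → v ∈ xs → v ≢ d
    xs-≢d v∈ refl = proj₂ (ind-inner xs (ind-tail rest)) v∈

    xs#leg₁ : ∀ {v} → v ∈ xs → ¬ (v ~ p) → v #* leg 1F
    xs#leg₁ v∈ v≁p = #*-∷ (parent-≢ (lxs v∈) lp , v≁p) (apart-below (lxs v∈) ∘ m-level 1F)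

    xs#rm₂ : ∀ {v} → v ∈ xs → ¬ (v ~ r) → v #* (r ∷ m 2F)
    xs#rm₂ v∈ v≁r = #*-∷ (parent-≢ (lxs v∈) lr , v≁r) (apart-below (lxs v∈) ∘ m-level 2F)

    xs#leg₂ : ∀ {v} → v ∈ xs → ¬ (v ~ r) → ¬ (v ~ d) → v #* leg 2F
    xs#leg₂ v∈ v≁r v≁d = #*-∷ (xs-≢d v∈ , v≁d) (xs#rm₂ v∈ v≁r)

    leg₀-out-y : ∀ {v} → v ∈ leg 0F → y ≢ v
    leg₀-out-y v∈ refl = ind-∉ (ind 0F) (∈-++⁺ˡ v∈)

    leg₀-only-y : ∀ {v} → v ∈ leg 0F → y ~ v → v ≡ c
    leg₀-only-y v∈ = ind-second (ind 0F) (∈-++⁺ˡ v∈)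

    leg₀-ind : Ind (leg 0F)
    leg₀-ind = proj₁ (ind-inner (leg 0F) (ind-tail (ind 0F)))

    leg₀-out-t : ∀ {v} → v ∈ leg 0F → t ≢ v
    leg₀-out-t v∈ refl = proj₂ (ind-inner (leg 0F) (ind-tail (ind 0F))) v∈

    -- Two legs of the theta form an induced cycle. It is cut at `y`, `x` and `t`, so that the whole
    -- of leg `j` is one arc.
    theta-hole : ∀ {i j A x D} → i ≢ j → leg i ≡ A ++ x ∷ D → Hole y x t A (leg j) D
    theta-hole {i} {j} {A} {x} {D} ne eq = record
      { ind₁₂ = proj₁ split ; ind₁₃ = ind j ; ind₂₃ = proj₁ (proj₂ split)
      ; A⟂B = λ u∈ → far ne (in-leg (∈-++⁺ˡ u∈))
      ; A⟂D = λ u∈ v∈ → proj₂ (proj₂ split) (there u∈) (∈-++⁺ˡ v∈)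
      ; B⟂D = λ u∈ v∈ → far (ne ∘ ≡-sym) u∈ (in-leg (∈-++⁺ʳ A (there v∈)))
      ; off₁ = λ v∈ → proj₂ (proj₂ split) (here refl) (∈-++⁺ˡ v∈)
      ; off₂ = far ne (in-leg (∈-++⁺ʳ A (here refl)))
      ; off₃ = λ v∈ → #-sym (proj₂ (proj₂ split) (there v∈) (∈-snoc D))
      }
      where
      in-leg : ∀ {v} → v ∈ A ++ x ∷ D → v ∈ leg i
      in-leg {v} = subst (v ∈_) (≡-sym eq)
      split = ind-split (y ∷ A) (subst (λ L → Ind (y ∷ L))
        (trans (cong (_++ [ t ]) eq) (++-assoc A (x ∷ D) [ t ])) (ind i))

    module Walking {E₀ e E₁} (eq : xs ≡ E₀ ++ e ∷ E₁) (E₀-miss : ∀ {v} → v ∈ E₀ → ¬ Hit v) where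

      E₀∈xs : ∀ {v} → v ∈ E₀ → v ∈ xs
      E₀∈xs {v} v∈ = subst (v ∈_) (≡-sym eq) (∈-++⁺ˡ v∈)

      e∈xs : e ∈ xs
      e∈xs = subst (e ∈_) (≡-sym eq) (∈-++⁺ʳ E₀ (here refl))

      le : level e ≡ suc k
      le = lxs e∈xs

      indE : Ind (c ∷ E₀ ++ [ e ])
      indE = proj₁ (ind-split (c ∷ E₀) (subst (λ L → Ind (c ∷ L))
        (trans (cong (_++ [ d ]) eq) (++-assoc E₀ (e ∷ E₁) [ d ])) rest))

      E₀⟂leg : ∀ i → 0F ≢ i → E₀ ⟂ leg i
      E₀⟂leg 0F ne u∈ = contradiction refl ne
      E₀⟂leg 1F ne u∈ = xs#leg₁ (E₀∈xs u∈) (E₀-miss u∈ ∘ inj₁)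
      E₀⟂leg 2F ne u∈ = xs#leg₂ (E₀∈xs u∈) (E₀-miss u∈ ∘ inj₂ ∘ inj₁) (E₀-miss u∈ ∘ inj₂ ∘ inj₂)

      -- Legs `i` and `j` form the hole, on which `x` is the only neighbour of `e`. Leg 0 together
      -- with the part of the cycle from `c` to `e` touches it at `y` by `c`, at `x` by `e` and at
      -- `t` by the end of leg 0.
      one-hit-impossible : ∀ {i j A x D} → 0F ≢ i → 0F ≢ j → i ≢ j → leg i ≡ A ++ x ∷ D →
        e ~ x → e #* A → e #* D → e #* leg j → ⊥
      one-hit-impossible {i} {j} {A} {x} {D} 0≢i 0≢j i≢j eqi e~x e#A e#D e#leg =
        no-K4 (fan (theta-hole i≢j eqi) {K = K}
          (λ k∈ v∈ → K⟂ k∈ (e#A v∈) (∈-++⁺ˡ v∈)) K⟂leg (λ k∈ v∈ → K⟂ k∈ (e#D v∈) (∈-++⁺ʳ A (there v∈))) no-triangle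
          (attached (inj₁ (here refl)) y~c
            (λ { (inj₁ m) → leg₀-out-y m ; (inj₂ m) → proj₁ (y#xs (E∈xs m)) })
            λ { (inj₁ m) a → leg₀-only-y m a ; (inj₂ m) a → contradiction a (proj₂ (y#xs (E∈xs m))) })
          (attached (inj₂ (∈-snoc E₀)) (sym G e~x) out-x only-x)
          (attached (inj₁ (last-∈ z-last)) (ind-last-~ (ind-tail (ind 0F)) z-last)
            (λ { (inj₁ m) → leg₀-out-t m ; (inj₂ m) → proj₁ (#-sym (apart-below (lxs (E∈xs m)) t-level)) })
            λ { (inj₁ m) a → ind-last (ind-tail (ind 0F)) z-last m a
              ; (inj₂ m) a → contradiction (sym G a) (proj₂ (apart-below (lxs (E∈xs m)) t-level)) })
          c→z (walk-sym (path-walk indE K-E (there (∈-snoc E₀))) ++ʷ c→z))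
        where
        K : V → Set
        K v = v ∈ leg 0F ⊎ v ∈ E₀ ++ [ e ]
        K-E : ∀ {v} → v ∈ c ∷ E₀ ++ [ e ] → K v
        K-E (here refl) = inj₁ (here refl)
        K-E (there m)   = inj₂ m
        E∈xs : ∀ {v} → v ∈ E₀ ++ [ e ] → v ∈ xs
        E∈xs m with ∈-snoc⁻ E₀ m
        ... | inj₁ m'   = E₀∈xs m'
        ... | inj₂ refl = e∈xs
        in-leg : ∀ {v} → v ∈ A ++ x ∷ D → v ∈ leg i
        in-leg {v} = subst (v ∈_) (≡-sym eqi)
        x∈ : x ∈ leg i
        x∈ = in-leg (∈-++⁺ʳ A (here refl))
        K⟂ : ∀ {u v} → K u → e # v → v ∈ A ++ x ∷ D → u # v
        K⟂ (inj₁ m) _ v∈ = far 0≢i m (in-leg v∈)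
        K⟂ (inj₂ m) e#v v∈ with ∈-snoc⁻ E₀ m
        ... | inj₁ m'   = E₀⟂leg i 0≢i m' (in-leg v∈)
        ... | inj₂ refl = e#v
        K⟂leg : ∀ {u} → K u → u #* leg j
        K⟂leg (inj₁ m) = far 0≢j m
        K⟂leg (inj₂ m) with ∈-snoc⁻ E₀ m
        ... | inj₁ m'   = E₀⟂leg j 0≢j m'
        ... | inj₂ refl = e#leg
        out-x : ∀ {v} → K v → x ≢ v
        out-x (inj₁ m) = proj₁ (far (0≢i ∘ ≡-sym) x∈ m)
        out-x (inj₂ m) with ∈-snoc⁻ E₀ m
        ... | inj₁ m'   = proj₁ (#-sym (E₀⟂leg i 0≢i m' x∈))
        ... | inj₂ refl = ~⇒≢ (sym G e~x)
        only-x : ∀ {v} → K v → x ~ v → v ≡ e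
        only-x (inj₁ m) a = contradiction a (proj₂ (far (0≢i ∘ ≡-sym) x∈ m))
        only-x (inj₂ m) a with ∈-snoc⁻ E₀ m
        ... | inj₁ m'   = contradiction (sym G a) (proj₂ (E₀⟂leg i 0≢i m' x∈))
        ... | inj₂ v≡e  = v≡e
        c→z : Walk K c z
        c→z = path-walk leg₀-ind inj₁ (last-∈ z-last)

      -- When e sees q the vertices of E₀ are dropped, so that e has a single neighbour in K₀.
      K₀ : V → Set
      K₀ v = v ∈ leg 0F ⊎ (¬ (e ~ q) × v ∈ E₀)

      e≢K₀ : ∀ {v} → K₀ v → e ≢ v
      e≢K₀ (inj₁ (here refl)) = ind-head-≢ E₀ indE ∘ ≡-sym
      e≢K₀ (inj₁ (there (here refl))) = parent-≢ le lq
      e≢K₀ (inj₁ (there (there m'))) = proj₁ (apart-below le (m-level 0F m'))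
      e≢K₀ (inj₂ (_ , m')) refl = proj₂ (ind-inner E₀ (ind-tail indE)) m'

      -- The contact of `e` with `K₀` is `q` if they are adjacent, in which case `c` is not a
      -- neighbour by triangle-freeness; otherwise it is the vertex just before `e` on the path from
      -- `c`.
      gate : ∃[ g ] K₀ g × e ~ g × (∀ {v} → K₀ v → e ~ v → v ≡ g) × Walk K₀ c g
      gate = choose (e ~? q)
        where
        choose : Dec (e ~ q) → ∃[ g ] K₀ g × e ~ g × (∀ {v} → K₀ v → e ~ v → v ≡ g) × Walk K₀ c g
        choose (yes e~q) = q , inj₁ (there (here refl)) , e~q , only , path-walk leg₀-ind inj₁ (there (here refl))
          where
          only : ∀ {v} → K₀ v → e ~ v → v ≡ q
          only (inj₁ (here refl)) a = contradiction e~q (triangle a c~q)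
          only (inj₁ (there (here eq))) _ = eq
          only (inj₁ (there (there m'))) a = contradiction a (proj₂ (apart-below le (m-level 0F m')))
          only (inj₂ (e≁q , _)) _ = contradiction e~q e≁q
        choose (no e≁q) with g , pg ← ∃-last c E₀ =
          g , member (last-∈ pg) , ind-last-~ indE pg , only , path-walk (proj₁ (ind-inner (c ∷ E₀) indE)) member (last-∈ pg)
          where
          member : ∀ {v} → v ∈ c ∷ E₀ → K₀ v
          member (here refl) = inj₁ (here refl)
          member (there m')  = inj₂ (e≁q , m')
          only : ∀ {v} → K₀ v → e ~ v → v ≡ g
          only (inj₁ (here refl)) a = ind-last indE pg (here refl) a
          only (inj₁ (there (here refl))) a = contradiction a e≁q
          only (inj₁ (there (there m'))) a = contradiction a (proj₂ (apart-below le (m-level 0F m')))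
          only (inj₂ (_ , m')) a = ind-last indE pg (there m') a

      K₀⟂leg : ∀ {i} → 0F ≢ i → ∀ {v} → K₀ v → v #* leg i
      K₀⟂leg ne (inj₁ m')       = far ne m'
      K₀⟂leg {i} ne (inj₂ (_ , m')) = E₀⟂leg i ne m'

      t-out : ∀ {v} → K₀ v → t ≢ v
      t-out (inj₁ m')       = leg₀-out-t m'
      t-out (inj₂ (_ , m')) = proj₁ (#-sym (apart-below (lxs (E₀∈xs m')) t-level))

      t-only : ∀ {v} → K₀ v → t ~ v → v ≡ z
      t-only (inj₁ m') a       = ind-last (ind-tail (ind 0F)) z-last m' a
      t-only (inj₂ (_ , m')) a = contradiction (sym G a) (proj₂ (apart-below (lxs (E₀∈xs m')) t-level))

      y-out : ∀ {v} → K₀ v → y ≢ v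
      y-out (inj₁ m')       = leg₀-out-y m'
      y-out (inj₂ (_ , m')) = proj₁ (y#xs (E₀∈xs m'))

      y-only : ∀ {v} → K₀ v → y ~ v → v ≡ c
      y-only (inj₁ m') a       = leg₀-only-y m' a
      y-only (inj₂ (_ , m')) a = contradiction a (proj₂ (y#xs (E₀∈xs m')))

      c→z : Walk K₀ c z
      c→z = path-walk leg₀-ind inj₁ (last-∈ z-last)

      c∈K₀ : K₀ c
      c∈K₀ = inj₁ (here refl)

      -- Here `e`, leg 1, `t` and leg 2 without `d` form the hole. The vertex `y` joined to `K₀`
      -- touches it at `p` by `y`, at `e` by the gate and at `t` by the end of leg 0.
      hits-p-r-impossible : e ~ p → e ~ r → ⊥
      hits-p-r-impossible e~p e~r with g , g∈ , e~g , g-only , c→g ← gate =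
        no-K4 (fan hole {K = K} (λ _ ()) K⟂B K⟂D no-triangle
          (attached (inj₂ g∈) e~g
            (λ { (inj₁ refl) → proj₁ e#y ; (inj₂ k∈) → e≢K₀ k∈ })
            λ { (inj₁ refl) a → contradiction a (proj₂ e#y) ; (inj₂ k∈) a → g-only k∈ a })
          (attached (inj₁ refl) (sym G y~p)
            (λ { (inj₁ refl) → ~⇒≢ (sym G y~p) ; (inj₂ k∈) eq → proj₁ (K₀⟂leg 0≢1 k∈ (here refl)) (≡-sym eq) })
            λ { (inj₁ eq) _ → eq ; (inj₂ k∈) a → contradiction (sym G a) (proj₂ (K₀⟂leg 0≢1 k∈ (here refl))) })
          (attached (inj₂ (inj₁ (last-∈ z-last))) (ind-last-~ (ind-tail (ind 0F)) z-last)
            (λ { (inj₁ refl) → proj₁ (#-sym t#y) ; (inj₂ k∈) → t-out k∈ })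
            λ { (inj₁ refl) a → contradiction (sym G a) (proj₂ t#y) ; (inj₂ k∈) a → t-only k∈ a })
          (walk-map inj₂ (walk-sym c→g ++ʷ c→z))
          (step (inj₁ refl) y~c (walk-map inj₂ c→z)))
        where
        K : V → Set
        K v = v ≡ y ⊎ K₀ v
        0≢1 : 0F ≢ 1F
        0≢1 ()
        0≢2 : 0F ≢ 2F
        0≢2 ()
        e#y : e # y
        e#y = #-sym (y#xs e∈xs)
        K⟂B : ∀ {v} → K v → v #* (r ∷ m 2F)
        K⟂B (inj₁ refl) v∈ with cons _ f _ ← ind 2F = f (∈-++⁺ˡ v∈)
        K⟂B (inj₂ k∈) v∈ = K₀⟂leg 0≢2 k∈ (there v∈)
        K⟂D : ∀ {v} → K v → v #* m 1F
        K⟂D (inj₁ refl) v∈ = apart-below ly (m-level 1F v∈)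
        K⟂D (inj₂ k∈) v∈ = K₀⟂leg 0≢1 k∈ (there v∈)
        hole : Hole e p t [] (r ∷ m 2F) (m 1F)
        hole = record
          { ind₁₂ = edge e~p
          ; ind₁₃ = cons e~r (#*-++ (m 2F) (apart-below le ∘ m-level 2F) λ { (here refl) → apart-below le t-level })
                      (ind-tail (ind-tail (ind 2F)))
          ; ind₂₃ = ind-tail (ind 1F)
          ; A⟂B = λ () ; A⟂D = λ () ; B⟂D = λ u∈ v∈ → far {2F} {1F} (λ ()) (there u∈) (there v∈)
          ; off₁ = apart-below le ∘ m-level 1F
          ; off₂ = λ v∈ → far {1F} {2F} (λ ()) (here refl) (there v∈)
          ; off₃ = λ () }

      -- The hole is the 4-cycle `y`, `p`, `e`, `d`. The set `K₀`, prolonged through `t` along leg 1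
      -- back towards `p`, touches it at `y` by `c`, at `e` by the gate and at `p`.
      hits-p-d-impossible : e ~ p → e ~ d → ⊥
      hits-p-d-impossible e~p e~d
        with g , g∈ , e~g , g-only , c→g ← gate
        with f , f∈ , p~f , f-only , walks ← leg-start (m 1F) (ind-tail (ind 1F)) =
        no-K4 (fan hole {K = K} (λ _ ()) K⟂B (λ _ ()) no-triangle
          (attached (inj₁ c∈K₀) y~c
            (λ { (inj₁ k∈) → y-out k∈ ; (inj₂ m') → proj₁ (apart-below ly (up m')) })
            λ { (inj₁ k∈) a → y-only k∈ a ; (inj₂ m') a → contradiction a (proj₂ (apart-below ly (up m'))) })
          (attached (inj₂ f∈) p~f
            (λ { (inj₁ k∈) eq → proj₁ (K₀⟂leg 0≢1 k∈ (here refl)) (≡-sym eq)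
               ; (inj₂ m') refl → ind-∉ (ind-tail (ind 1F)) m' })
            λ { (inj₁ k∈) a → contradiction (sym G a) (proj₂ (K₀⟂leg 0≢1 k∈ (here refl))) ; (inj₂ m') a → f-only m' a })
          (attached (inj₁ g∈) e~g
            (λ { (inj₁ k∈) → e≢K₀ k∈ ; (inj₂ m') → proj₁ (apart-below le (up m')) })
            λ { (inj₁ k∈) a → g-only k∈ a ; (inj₂ m') a → contradiction a (proj₂ (apart-below le (up m'))) })
          (walk-map inj₁ c→g)
          (walks inj₂ (∈-snoc (m 1F)) ++ʷ step (inj₂ (∈-snoc (m 1F))) (ind-last-~ (ind-tail (ind 0F)) z-last)
            (walk-map inj₁ (walk-sym c→z ++ʷ c→g))))
        where
        K : V → Set
        K v = K₀ v ⊎ v ∈ m 1F ++ [ t ]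
        0≢1 : 0F ≢ 1F
        0≢1 ()
        0≢2 : 0F ≢ 2F
        0≢2 ()
        up : ∀ {v} → v ∈ m 1F ++ [ t ] → level v < k
        up v∈ = [ m-level 1F , (λ { refl → t-level }) ]′ (∈-snoc⁻ (m 1F) v∈)
        K⟂B : ∀ {v} → K v → v #* [ d ]
        K⟂B (inj₁ k∈) (here refl) = K₀⟂leg 0≢2 k∈ (here refl)
        K⟂B (inj₂ m') (here refl) = #-sym (apart-below ld (up m'))
        hole : Hole y p e [] [ d ] []
        hole = record
          { ind₁₂ = edge y~p
          ; ind₁₃ = cons y~d (λ { (here refl) → y#xs e∈xs }) (edge (sym G e~d))
          ; ind₂₃ = edge (sym G e~p)
          ; A⟂B = λ () ; A⟂D = λ () ; B⟂D = λ _ () ; off₁ = λ ()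
          ; off₂ = λ { (here refl) → #-sym d#p } ; off₃ = λ () }

      -- Since `d` and `r` are adjacent, `e` sees at most one of them; the remaining combinations
      -- are the two double hits and three single ones.
      hit-impossible : ¬ Hit e
      hit-impossible h with e ~? p | e ~? r | e ~? d
      ... | _       | yes e~r | yes e~d = triangle e~d d~r e~r
      ... | yes e~p | yes e~r | no _    = hits-p-r-impossible e~p e~r
      ... | yes e~p | no _    | yes e~d = hits-p-d-impossible e~p e~d
      ... | yes e~p | no e≁r  | no e≁d  =
        one-hit-impossible {1F} {2F} {A = []} (λ ()) (λ ()) (λ ()) refl e~p (λ ()) (apart-below le ∘ m-level 1F)
          (xs#leg₂ e∈xs e≁r e≁d)
      ... | no e≁p  | yes e~r | no e≁d  =
        one-hit-impossible {2F} {1F} {A = [ d ]} (λ ()) (λ ()) (λ ()) refl e~r (λ { (here refl) → xs-≢d e∈xs , e≁d })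
          (apart-below le ∘ m-level 2F) (xs#leg₁ e∈xs e≁p)
      ... | no e≁p  | no e≁r  | yes e~d =
        one-hit-impossible {2F} {1F} {A = []} (λ ()) (λ ()) (λ ()) refl e~d (λ ()) (xs#rm₂ e∈xs e≁r) (xs#leg₁ e∈xs e≁p)
      ... | no e≁p  | no e≁r  | no e≁d  = [ e≁p , [ e≁r , e≁d ]′ ]′ h

    impossible : ⊥
    impossible with E₀ , e , E₁ , eq , hit , miss ← first-such hit? some-hit = Walking.hit-impossible eq miss hit

  -- Unless `PrivateParents` applies around `v` or around `a`, the neighbours of `v` on the cycle
  -- have a common parent and so do those of `a`; then the path `b`, `v`, `a`, `x` falls under
  -- `shared-parents-impossible`.
  no-long-hole : ∀ {v a x x' xs b i} → level v ≡ i → (∀ {u} → u ∈ a ∷ x ∷ x' ∷ xs ++ [ b ] → level u ≡ i) →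
    v ~ a → v ~ b → v #* (x ∷ x' ∷ xs) → ¬ Ind (a ∷ x ∷ x' ∷ xs ++ [ b ])
  no-long-hole {v} {a} {i = zero} lv lev v~a v~b v# ind =
    -- Layer 0 has one vertex per component, hence no edge.
    ~⇒≢ v~a (trans (level-0 lv) (trans (root-~ v~a) (≡-sym (level-0 (lev (here refl))))))
  no-long-hole {v} {a} {x} {x'} {xs} {b} {suc k} lv lev v~a v~b v# ind@(cons a~x a# ind′@(cons x~x' x# _)) =
    absurd
    where
    la : level a ≡ suc k
    la = lev (here refl)
    lx : level x ≡ suc k
    lx = lev (there (here refl))
    b∈ : b ∈ x' ∷ xs ++ [ b ]
    b∈ = there (∈-snoc xs)
    lb : level b ≡ suc k
    lb = lev (there (there b∈))
    comparable : ∀ u w → level u ≡ suc k → level w ≡ suc k →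
      (∃[ q ] level q ≡ k × u ~ q × w ~ q) ⊎
      (∃[ q ] ∃[ r ] level q ≡ k × level r ≡ k × u ~ q × w ~ r × ¬ (w ~ q) × ¬ (u ~ r))
    comparable u w lu lw
      with q , u~q , lq ← parent lu
      with r , w~r , lr ← parent lw
      with w ~? q | u ~? r
    ... | yes w~q | _       = inj₁ (q , lq , u~q , w~q)
    ... | no _    | yes u~r = inj₁ (r , lr , u~r , w~r)
    ... | no w≁q  | no u≁r  = inj₂ (q , r , lq , lr , u~q , w~r , w≁q , u≁r)
    -- The cycle without `a`, for repeating the argument with `a` as the middle vertex.
    ind-rotated : Ind (x ∷ (x' ∷ xs ++ [ b ]) ++ [ v ])
    ind-rotated = ind-snoc ind′ (last-snoc (x ∷ x' ∷ xs)) (sym G v~b)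
      λ u∈ u≢b → [ (λ u∈′ → #-sym (v# u∈′)) , (λ u≡b → contradiction u≡b u≢b) ]′ (∈-snoc⁻ (x ∷ x' ∷ xs) u∈)
    absurd : ⊥
    absurd with comparable a b la lb
    ... | inj₂ (q , r , lq , lr , a~q , b~r , b≁q , a≁r) with p , v~p , lp ← parent lv =
      PrivateParents.impossible la lv lb (λ u∈ → lev (there (∈-++⁺ˡ u∈))) lp lq lr v~a v~b ind v# v~p a~q b~r b≁q a≁r
    ... | inj₁ (q , lq , a~q , b~q) with comparable x v lx lv
    ...   | inj₂ (q' , r , lq' , lr , x~q' , v~r , v≁q' , x≁r) with p , a~p , lp ← parent la =
      PrivateParents.impossible lx la lv (λ u∈ → lev (there (there u∈))) lp lq' lr a~x (sym G v~a) ind-rotated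
        a# a~p x~q' v~r v≁q' x≁r
    ...   | inj₁ (r , lr , x~r , v~r) =
      -- Length at least five enters here: `x'` separates `x` from `b`, so these two are not
      -- adjacent.
      shared-parents-impossible lb lv la lx lq lr (sym G v~b) v~a a~x (#-sym (x# (∈-snoc xs)))
        (proj₁ (v# (here refl))) (proj₁ (#-sym (a# b∈))) b~q a~q v~r x~r

-- Every layer is bipartite.

layerGraph : ∀ {n} {G : Graph n} → Layering G → Graph n
layerGraph {G = G} L = record
  { Adj    = λ u v → Adj G u v × level u ≡ level v
  ; adj?   = λ u v → adj? G u v ×-dec (level u ℕ.≟ level v)
  ; sym    = λ (e , eq) → sym G e , ≡-sym eq
  ; irrefl = λ (e , _) → irrefl G e
  }
  where open Layering L

module BipartiteLayers {n : ℕ} (G : Graph n) (no-triangle : ¬ HasTriangle G) (no-K4 : ¬ InducedK4Subdivision G)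
                       (L : Layering G) (L′ : Layering (layerGraph L)) where

  open InducedPaths G
  open Layering L
  open NoLongHole G no-triangle no-K4 L using (no-long-hole)
  module P′ = InducedPaths (layerGraph L)
  module L′ = Layering L′
  open LayeringProperties L′ using (up-walk)

  ind′-level : ∀ {x l v} → P′.Ind (x ∷ l) → v ∈ x ∷ l → level v ≡ level x
  ind′-level i (here refl) = refl
  ind′-level (P′.cons (_ , eq) _ i) (there v∈) = trans (ind′-level i v∈) (≡-sym eq)

  #′⇒# : ∀ {u v} → level u ≡ level v → u P′.# v → u # v
  #′⇒# eq (u≢v , u≁v) = u≢v , λ e → u≁v (e , eq)

  -- A path of the layer graph stays in one layer, where its adjacency agrees with that of `G`.
  ind′⇒ind : ∀ {xs} → P′.Ind xs → Ind xs
  ind′⇒ind P′.[] = []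
  ind′⇒ind P′.[-] = [-]
  ind′⇒ind i@(P′.cons (e , _) f j) =
    cons e (λ v∈ → #′⇒# (≡-sym (ind′-level i (there (there v∈)))) (f v∈)) (ind′⇒ind j)

  inner-low : ∀ {k v w zs x} → P′.Ind (w ∷ zs ++ [ v ]) → (∀ {x} → x ∈ zs → x ≡ v ⊎ L′.level x ≤ k) →
              L′.level w ≡ k → x ∈ w ∷ zs → L′.level x ≤ k
  inner-low i K-zs lw (here refl) = ℕ.≤-reflexive lw
  inner-low {zs = zs} i K-zs lw (there m) with K-zs m
  ... | inj₁ refl = contradiction m (proj₂ (P′.ind-inner zs (P′.ind-tail i)))
  ... | inj₂ le   = le

  -- Bipartiteness of the layer graph, by induction on the second level. An edge inside such a level
  -- is completed, through vertices closer to the second root, to an induced cycle in one layer of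
  -- `G`, of length 3, 4 or at least 5.
  levels′-differ : ∀ k {u v} → u P′.~ v → L′.level u ≡ k → L′.level v ≡ k → ⊥
  levels′-differ zero e lu lv =
    P′.~⇒≢ e (trans (L′.level-0 lu) (trans (L′.root-~ e) (≡-sym (L′.level-0 lv))))
  levels′-differ (suc k) {u} {v} e lu lv
    with w , u~w , lw ← L′.parent lu
    with zs , ind-zs , K-zs ← P′.walk⇒path′ {K = λ x → x ≡ v ⊎ L′.level x ≤ k}
           (λ { refl → ℕ.1+n≢n (trans (≡-sym lv) lw) })
           (up-walk (inj₂ (ℕ.≤-reflexive lw)) (λ lt → inj₂ (ℕ.<⇒≤ (subst (_ <_) lw lt))) P′.++ʷ
             subst (λ r → P′.Walk _ r v) (trans (≡-sym (L′.root-~ e)) (L′.root-~ u~w))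
               (P′.walk-sym (up-walk (inj₁ refl) λ {x} lt → inj₂ (s≤s⁻¹ (subst (L′.level x <_) lv lt)))))
    -- Cutting at the last neighbour of `u` makes `u`, `a`, `P`, `v` an induced cycle.
    with ys , a , P , eq , u~a , u#P ← P′.last-neighbour {u} {w ∷ zs}
           (λ m → ℕ.<-irrefl refl (subst (_≤ k) lu (inner-low ind-zs K-zs lw m))) (here u~w) =
    close P u#P (proj₁ (proj₂ (P′.ind-split ys (subst P′.Ind
        (trans (cong (_++ [ v ]) eq) (++-assoc ys (a ∷ P) [ v ])) ind-zs))))
      (λ m → inner-low ind-zs K-zs lw (subst (_ ∈_) (≡-sym eq) (∈-++⁺ʳ ys m))) u~a
    where
    exact : ∀ {x x'} → x P′.~ x' → L′.level x ≤ k → L′.level x' ≡ suc k → L′.level x ≡ k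
    exact {x} x~x' le lx' = ℕ.≤-antisym le (s≤s⁻¹ (subst (_≤ suc (L′.level x)) lx' (L′.level-~ x~x')))
    close : ∀ {a} P → u P′.#* P → P′.Ind (a ∷ P ++ [ v ]) → (∀ {x} → x ∈ a ∷ P → L′.level x ≤ k) → u P′.~ a → ⊥
    close [] u#P (P′.cons a~v _ _) le u~a = no-triangle (_ , _ , _ , proj₁ u~a , proj₁ a~v , proj₁ e)
    -- In a 4-cycle `a` and `x` both have level exactly `k`, so the induction hypothesis excludes
    -- the edge between them.
    close (x ∷ []) u#P (P′.cons a~x _ (P′.cons x~v _ _)) le u~a =
      levels′-differ k a~x (exact (sym (layerGraph L) u~a) (le (here refl)) lu) (exact x~v (le (there (here refl))) lv)
    close (x ∷ x' ∷ xs) u#P i le u~a =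
      no-long-hole refl on-layer (proj₁ u~a) (proj₁ e)
        (λ m → #′⇒# (≡-sym (on-layer (there (∈-++⁺ˡ m)))) (u#P m)) (ind′⇒ind i)
      where
      on-layer : ∀ {y} → y ∈ _ → level y ≡ level u
      on-layer m = trans (ind′-level i m) (≡-sym (proj₂ u~a))

-- Parity of levels and the four colours.

flip : Fin 2 → Fin 2
flip 0F = 1F
flip 1F = 0F

flip-injective : ∀ {x y} → flip x ≡ flip y → x ≡ y
flip-injective {0F} {0F} _ = refl
flip-injective {0F} {1F} ()
flip-injective {1F} {0F} ()
flip-injective {1F} {1F} _ = refl

parity : ℕ → Fin 2
parity zero    = 0F
parity (suc k) = flip (parity k)

parity-close : ∀ {j k} → j ≤ suc k → k ≤ suc j → parity j ≡ parity k → j ≡ k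
parity-close {zero}        {zero}        _ _ _ = refl
parity-close {zero}        {suc zero}    _ _ ()
parity-close {zero}        {suc (suc k)} _ (s≤s ()) _
parity-close {suc zero}    {zero}        _ _ ()
parity-close {suc (suc j)} {zero}        (s≤s ()) _ _
parity-close {suc j}       {suc k}       (s≤s p) (s≤s q) eq = cong suc (parity-close p q (flip-injective eq))

level-parity : ∀ {n} {G : Graph n} (L : Layering G) {u v} → Adj G u v →
  parity (Layering.level L u) ≡ parity (Layering.level L v) → Layering.level L u ≡ Layering.level L v
level-parity {G = G} L e = parity-close (Layering.level-~ L (sym G e)) (Layering.level-~ L e)

theorem1p7 : ∀ {n : ℕ} (G : Graph n) → ¬ HasTriangle G → ¬ InducedK4Subdivision G →
    ChromaticAtMost G 4
theorem1p7 {n} G no-triangle no-K4 = colour , proper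
  where
  L  = BreadthFirst.layering G
  -- One layering of the graph of all edges inside layers treats every component of every layer at
  -- once.
  L′ = BreadthFirst.layering (layerGraph L)
  open Layering L using (level)
  open Layering L′ using () renaming (level to level′)
  open BipartiteLayers G no-triangle no-K4 L L′
  colour : Fin n → Fin 4
  -- The first parity separates neighbouring layers. Adjacent vertices that agree in it share a
  -- layer, and the second parity separates them there.
  colour v = combine (parity (level v)) (parity (level′ v))
  proper : ProperColouring G 4 colour
  proper u v e eq
    with eq₁ , eq₂ ← Fin.combine-injective (parity (level u)) (parity (level′ u)) (parity (level v)) (parity (level′ v)) eq
    with same ← level-parity L e eq₁ =
    levels′-differ (level′ u) (e , same) refl (≡-sym (level-parity L′ (e , same) eq₂))
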